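{- For every integer $r\ge1$, $$\mathcal{T}_{r+1}(x_1,\ldots,x_{r+1};q) = (-x_{r+1}q^{\frac12};q)_\infty\; \mathcal{A}_r(x_1,\ldots,x_r,x_{r+1};q).$$
   Context: Here $|q|<1$ and $x_1,\ldots,x_{r+1}$ are indeterminates or complex numbers (identities may be read as formal power series in $q^{1/2}$ with coefficients polynomial in the $x_i$). $q$-Pochhammer symbol: for $n\in\mathbb{Z}_{\ge0}\cup\{\infty\}$, $(a)_n=(a;q)_n:=\prod_{k=0}^{n-1}(1-aq^k)$, with the usual convention $1/(q;q)_n=0$ for negative integers $n$, so that the sums over $\mathbb{Z}^r$ below are effectively over $\mathbb{Z}_{\ge0}^r$. Tadpole Nahm sum: let $\mathbf{T}_r$ be the $r\times r$ matrix with $\mathbf{T}_r(i,i)=2$ for $i<r$, $\mathbf{T}_r(r,r)=1$, $\mathbf{T}_r(i,j)=-1$ if $i=j\pm1$, and all other entries $0$. Define $$\mathcal{T}_r(x_1,\ldots,x_r;q):=\sum_{\mathbf{n}=(n_1,\ldots,n_r)\in\mathbb{Z}^r}\frac{q^{\frac12\mathbf{n}\mathbf{T}_r\mathbf{n}^{\mathsf T}}x_1^{n_1}\cdots x_r^{n_r}}{(q;q)_{n_1}\cdots(q;q)_{n_r}}.$$ The sum $\mathcal{A}_r$: let $\mathbf{A}_r$ be the type $A_r$ Cartan matrix, i.e. the $r\times r$ matrix with $\mathbf{A}_r(i,i)=2$, $\mathbf{A}_r(i,j)=-1$ if $i=j\pm1$, and all other entries $0$. Define $$\mathcal{A}_r(x_1,\ldots,x_r,z;q):=\sum_{\mathbf{n}=(n_1,\ldots,n_r)\in\mathbb{Z}^r}\frac{q^{\frac12\mathbf{n}\mathbf{A}_r\mathbf{n}^{\mathsf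 T}}x_1^{n_1}\cdots x_r^{n_r}\,(-zq^{\frac12-n_r};q)_{n_r}}{(q;q)_{n_1}\cdots(q;q)_{n_r}}.$$ -}

module Defs where

open import Algebra.Bundles using (CommutativeRing; RawRing; Semiring)
open import Data.Bool.Base using (Bool; if_then_else_; _∨_)
open import Data.Fin.Base using (Fin; zero; suc; toℕ)
import Data.Fin.Properties as Fin
open import Data.Integer.Base as ℤ using (ℤ; +_; -[1+_]; 0ℤ; 1ℤ; -1ℤ)
import Data.Integer.Properties as ℤ
open import Data.Integer.Tactic.RingSolver using (solve-∀)
open import Data.Nat.Base as ℕ using (ℕ; zero; suc; _≡ᵇ_)
open import Data.Nat.Divisibility using (_∣_; _∣?_; _∣0; ∣m∣n⇒∣m+n; ∣m+n∣m⇒∣n; ∣-refl; ∣⇒≤)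
import Data.Nat.Properties as ℕ
open import Data.Vec.Base using (Vec; []; _∷_; lookup; last)
open import Data.Vec.Functional using (Vector)
open import Function.Base using (_∘_)
open import Relation.Binary.PropositionalEquality as ≡ using (_≡_; _≢_; cong; cong₂; subst; subst₂)
open import Relation.Nullary using (¬_; Dec; yes; no; does; contradiction)
open import Relation.Nullary.Decidable using (dec-true; dec-false)

open import Algebra.Properties.CommutativeMonoid.Sum ℤ.+-0-commutativeMonoid
  using () renaming (sum to sumℤ; sum-cong-≗ to sumℤ-cong;
                     ∑-distrib-+ to sumℤ-+; sum-replicate-zero to sumℤ-0)

Matrix : ℕ → Set
Matrix r = Fin r → Fin r → ℤ

adjacent : ∀ {r} → Fin r → Fin r → Bool
adjacent i j = (toℕ i ≡ᵇ suc (toℕ j)) ∨ (toℕ j ≡ᵇ suc (toℕ i))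

-- Rows and columns are numbered from 0, so the last one is r - 1.
isLast : ∀ {r} → Fin r → Bool
isLast {r} i = suc (toℕ i) ≡ᵇ r

tadpole : ∀ r → Matrix r
tadpole r i j =
  if toℕ i ≡ᵇ toℕ j then (if isLast i then + 1 else + 2)
  else if adjacent i j then -1ℤ else 0ℤ

cartanA : ∀ r → Matrix r
cartanA r i j =
  if toℕ i ≡ᵇ toℕ j then + 2
  else if adjacent i j then -1ℤ else 0ℤ

quad : ∀ {r} → Matrix r → Vec ℕ r → ℤ
quad M n = sumℤ λ i → sumℤ λ j → + lookup n i ℤ.* M i j ℤ.* + lookup n j

quad-cons : ∀ {r} (M : Matrix (suc (suc r))) →
  M zero zero ≡ + 2 → M zero (suc zero) ≡ -1ℤ → M (suc zero) zero ≡ -1ℤ →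
  (∀ j → M zero (suc (suc j)) ≡ 0ℤ) → (∀ j → M (suc (suc j)) zero ≡ 0ℤ) →
  ∀ a b w → quad M (a ∷ b ∷ w) ≡
    (+ 2 ℤ.* (+ a ℤ.* + a) ℤ.- + 2 ℤ.* (+ a ℤ.* + b))
      ℤ.+ quad (λ i j → M (suc i) (suc j)) (b ∷ w)
quad-cons {r} M m00 m01 m10 m0 m′0 a b w = begin
  quad M v
    ≡⟨ cong (λ x → row zero ℤ.+ x) (sumℤ-+ (λ i → e (suc i) zero) rest) ⟩
  row zero ℤ.+ (col ℤ.+ sumℤ rest)
    ≡⟨ cong₂ (λ x y → x ℤ.+ (y ℤ.+ sumℤ rest)) row0 col0 ⟩
  (A ℤ.* + 2 ℤ.* A ℤ.+ (A ℤ.* -1ℤ ℤ.* B ℤ.+ 0ℤ))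
    ℤ.+ ((B ℤ.* -1ℤ ℤ.* A ℤ.+ 0ℤ) ℤ.+ sumℤ rest)
    ≡⟨ arith A B (sumℤ rest) ⟩
  _ ∎
  where
  open ≡.≡-Reasoning
  v = a ∷ b ∷ w
  A = + a
  B = + b
  e : Fin (suc (suc r)) → Fin (suc (suc r)) → ℤ
  e i j = + lookup v i ℤ.* M i j ℤ.* + lookup v j
  row : Fin (suc (suc r)) → ℤ
  row i = sumℤ (e i)
  rest : Fin (suc r) → ℤ
  rest i = sumℤ λ j → e (suc i) (suc j)
  col = sumℤ λ i → e (suc i) zero
  vanish : ∀ x y z → y ≡ 0ℤ → x ℤ.* y ℤ.* z ≡ 0ℤ
  vanish x _ z ≡.refl = cong (ℤ._* z) (ℤ.*-zeroʳ x)
  row0 : row zero ≡ A ℤ.* + 2 ℤ.* A ℤ.+ (A ℤ.* -1ℤ ℤ.* B ℤ.+ 0ℤ)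
  row0 = cong₂ ℤ._+_ (cong (λ x → A ℤ.* x ℤ.* A) m00)
    (cong₂ ℤ._+_ (cong (λ x → A ℤ.* x ℤ.* B) m01)
      (≡.trans (sumℤ-cong {r} λ j → vanish A _ (+ lookup w j) (m0 j)) (sumℤ-0 r)))
  col0 : col ≡ B ℤ.* -1ℤ ℤ.* A ℤ.+ 0ℤ
  col0 = cong₂ ℤ._+_ (cong (λ x → B ℤ.* x ℤ.* A) m10)
    (≡.trans (sumℤ-cong {r} λ j → vanish (+ lookup w j) _ A (m′0 j)) (sumℤ-0 r))
  arith : ∀ A B S →
    (A ℤ.* + 2 ℤ.* A ℤ.+ (A ℤ.* -1ℤ ℤ.* B ℤ.+ 0ℤ)) ℤ.+ ((B ℤ.* -1ℤ ℤ.* A ℤ.+ 0ℤ) ℤ.+ S)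
    ≡ (+ 2 ℤ.* (A ℤ.* A) ℤ.- + 2 ℤ.* (A ℤ.* B)) ℤ.+ S
  arith = solve-∀

tadpole-cons : ∀ {r} a b (w : Vec ℕ r) → quad (tadpole _) (a ∷ b ∷ w) ≡
  (+ 2 ℤ.* (+ a ℤ.* + a) ℤ.- + 2 ℤ.* (+ a ℤ.* + b)) ℤ.+ quad (tadpole _) (b ∷ w)
tadpole-cons = quad-cons (tadpole _) ≡.refl ≡.refl ≡.refl (λ _ → ≡.refl) (λ _ → ≡.refl)

cartanA-cons : ∀ {r} a b (w : Vec ℕ r) → quad (cartanA _) (a ∷ b ∷ w) ≡
  (+ 2 ℤ.* (+ a ℤ.* + a) ℤ.- + 2 ℤ.* (+ a ℤ.* + b)) ℤ.+ quad (cartanA _) (b ∷ w)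
cartanA-cons = quad-cons (cartanA _) ≡.refl ≡.refl ≡.refl (λ _ → ≡.refl) (λ _ → ≡.refl)

cartanA-tadpole : ∀ {r} (n : Vec ℕ (suc r)) →
  quad (cartanA _) n ≡ quad (tadpole _) n ℤ.+ + last n ℤ.* + last n
cartanA-tadpole (a ∷ []) = arith (+ a)
  where
  arith : ∀ A → A ℤ.* + 2 ℤ.* A ℤ.+ 0ℤ ℤ.+ 0ℤ ≡ A ℤ.* + 1 ℤ.* A ℤ.+ 0ℤ ℤ.+ 0ℤ ℤ.+ A ℤ.* A
  arith = solve-∀
cartanA-tadpole (a ∷ b ∷ w) = begin
  quad (cartanA _) (a ∷ b ∷ w)       ≡⟨ cartanA-cons a b w ⟩
  c ℤ.+ quad (cartanA _) (b ∷ w)     ≡⟨ cong (λ x → c ℤ.+ x) (cartanA-tadpole (b ∷ w)) ⟩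
  c ℤ.+ (quad (tadpole _) (b ∷ w) ℤ.+ l) ≡⟨ ℤ.+-assoc c _ l ⟨
  c ℤ.+ quad (tadpole _) (b ∷ w) ℤ.+ l   ≡⟨ cong (λ x → x ℤ.+ l) (tadpole-cons a b w) ⟨
  quad (tadpole _) (a ∷ b ∷ w) ℤ.+ l ∎
  where
  open ≡.≡-Reasoning
  c = + 2 ℤ.* (+ a ℤ.* + a) ℤ.- + 2 ℤ.* (+ a ℤ.* + b)
  l = + last (b ∷ w) ℤ.* + last (b ∷ w)

i≤i² : ∀ i → i ℤ.≤ i ℤ.* i
i≤i² (+ zero)  = ℤ.≤-refl
i≤i² (+ suc n) = ℤ.+≤+ (ℕ.m≤m*n (suc n) (suc n))
i≤i² -[1+ n ]  = ℤ.-≤+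

0≤i² : ∀ i → 0ℤ ℤ.≤ i ℤ.* i
0≤i² (+ zero)  = ℤ.≤-refl
0≤i² (+ suc n) = ℤ.+≤+ ℕ.z≤n
0≤i² -[1+ n ]  = ℤ.+≤+ ℕ.z≤n

shift-≤ : ∀ {x y x′ y′} c → x ℤ.≤ y → x ℤ.+ c ≡ x′ → y ℤ.+ c ≡ y′ → x′ ℤ.≤ y′
shift-≤ c x≤y ex ey = subst₂ ℤ._≤_ ex ey (ℤ.+-monoˡ-≤ c x≤y)

-- n T nᵀ = n₁² + Σ (nᵢ - nᵢ₊₁)², and d ≤ d² for integers.
tadpole-bound′ : ∀ {r} a (w : Vec ℕ r) i →
  + lookup (a ∷ w) i ℤ.+ + a ℤ.* + a ℤ.≤ quad (tadpole _) (a ∷ w) ℤ.+ + a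
tadpole-bound′ a [] zero = ℤ.≤-reflexive (arith (+ a))
  where
  arith : ∀ A → A ℤ.+ A ℤ.* A ≡ A ℤ.* + 1 ℤ.* A ℤ.+ 0ℤ ℤ.+ 0ℤ ℤ.+ A
  arith = solve-∀
tadpole-bound′ a (b ∷ w) i rewrite tadpole-cons a b w = go i
  where
  A = + a
  B = + b
  Q = quad (tadpole _) (b ∷ w)
  D = B ℤ.- A
  go : ∀ i → + lookup (a ∷ b ∷ w) i ℤ.+ A ℤ.* A
           ℤ.≤ (+ 2 ℤ.* (A ℤ.* A) ℤ.- + 2 ℤ.* (A ℤ.* B)) ℤ.+ Q ℤ.+ A
  go zero = shift-≤ (A ℤ.+ A ℤ.* A ℤ.- B ℤ.- B ℤ.* B)
    (ℤ.+-mono-≤ (tadpole-bound′ b w zero) (0≤i² D)) (lhs A B) (rhs A B Q)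
    where
    lhs : ∀ A B → (B ℤ.+ B ℤ.* B ℤ.+ 0ℤ) ℤ.+ (A ℤ.+ A ℤ.* A ℤ.- B ℤ.- B ℤ.* B) ≡ A ℤ.+ A ℤ.* A
    lhs = solve-∀
    rhs : ∀ A B Q → (Q ℤ.+ B ℤ.+ (B ℤ.- A) ℤ.* (B ℤ.- A)) ℤ.+ (A ℤ.+ A ℤ.* A ℤ.- B ℤ.- B ℤ.* B)
      ≡ (+ 2 ℤ.* (A ℤ.* A) ℤ.- + 2 ℤ.* (A ℤ.* B)) ℤ.+ Q ℤ.+ A
    rhs = solve-∀
  go (suc i) = shift-≤ (A ℤ.+ A ℤ.* A ℤ.- B ℤ.- B ℤ.* B)
    (ℤ.+-mono-≤ (tadpole-bound′ b w i) (i≤i² D)) (lhs A B (+ lookup (b ∷ w) i)) (rhs A B Q)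
    where
    lhs : ∀ A B V → (V ℤ.+ B ℤ.* B ℤ.+ (B ℤ.- A)) ℤ.+ (A ℤ.+ A ℤ.* A ℤ.- B ℤ.- B ℤ.* B) ≡ V ℤ.+ A ℤ.* A
    lhs = solve-∀
    rhs : ∀ A B Q → (Q ℤ.+ B ℤ.+ (B ℤ.- A) ℤ.* (B ℤ.- A)) ℤ.+ (A ℤ.+ A ℤ.* A ℤ.- B ℤ.- B ℤ.* B)
      ≡ (+ 2 ℤ.* (A ℤ.* A) ℤ.- + 2 ℤ.* (A ℤ.* B)) ℤ.+ Q ℤ.+ A
    rhs = solve-∀

tadpole-bound : ∀ {r} (n : Vec ℕ r) i → + lookup n i ℤ.≤ quad (tadpole r) n
tadpole-bound (a ∷ w) i = shift-≤ (ℤ.- (A ℤ.* A) ℤ.- A)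
  (ℤ.+-mono-≤ (tadpole-bound′ a w i) (i≤i² A)) (lhs A _) (rhs A _)
  where
  A = + a
  lhs : ∀ A V → (V ℤ.+ A ℤ.* A ℤ.+ A) ℤ.+ (ℤ.- (A ℤ.* A) ℤ.- A) ≡ V
  lhs = solve-∀
  rhs : ∀ A Q → (Q ℤ.+ A ℤ.+ A ℤ.* A) ℤ.+ (ℤ.- (A ℤ.* A) ℤ.- A) ≡ Q
  rhs = solve-∀

tadpole-nonneg : ∀ {r} (n : Vec ℕ r) → 0ℤ ℤ.≤ quad (tadpole r) n
tadpole-nonneg []        = ℤ.≤-refl
tadpole-nonneg n@(_ ∷ _) = ℤ.≤-trans (ℤ.+≤+ ℕ.z≤n) (tadpole-bound n zero)

-- Formal Laurent series in the variable t = q^{1/2}, so that q = t².  Negative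
-- exponents are needed for the polynomials (-z q^{1/2-n};q)_n.
module FormalSeries {c ℓ} (R : CommutativeRing c ℓ) where

  open CommutativeRing R hiding (zero)
  open import Algebra.Properties.Ring ring using (-0#≈0#; -1*x≈-x)
  open import Algebra.Properties.CommutativeMonoid.Sum +-commutativeMonoid public
    using (sum; sum-syntax)
  open import Algebra.Properties.CommutativeMonoid.Sum +-commutativeMonoid
    using (sum-cong-≋; ∑-distrib-+; sum-replicate-zero)
  open import Algebra.Definitions.RawSemiring (Semiring.rawSemiring semiring) public
    using (_^_; product)
  open import Relation.Binary.Reasoning.Setoid setoid hiding (start)

  -- Σ_{n ≥ 0} (num n) t^(start + n); num 0 is allowed to vanish.
  record Laurent : Set c where
    constructor laurent
    field
      start : ℤ
      num   : ℕ → Carrier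
  open Laurent public

  extend : (ℕ → Carrier) → ℤ → Carrier
  extend a (+ n)    = a n
  extend a -[1+ _ ] = 0#

  coeff : Laurent → ℤ → Carrier
  coeff f k = extend (num f) (k ℤ.- start f)

  -- Σ_{k ≥ s} (a k) t^k
  series : ℤ → (ℤ → Carrier) → Laurent
  series s a = laurent s λ n → a (s ℤ.+ + n)

  infix  4 _≈ᴸ_
  infixl 6 _+ᴸ_ _-ᴸ_
  infixl 7 _*ᴸ_
  infix  8 -ᴸ_
  infix  9 _·t^_

  _≈ᴸ_ : Laurent → Laurent → Set ℓ
  f ≈ᴸ g = ∀ k → coeff f k ≈ coeff g k

  _·t^_ : Carrier → ℤ → Laurent
  x ·t^ k = laurent k single
    where
    single : ℕ → Carrier
    single zero    = x
    single (suc _) = 0#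

  0ᴸ 1ᴸ : Laurent
  0ᴸ = 0# ·t^ 0ℤ
  1ᴸ = 1# ·t^ 0ℤ

  _+ᴸ_ : Laurent → Laurent → Laurent
  f +ᴸ g = series (start f ℤ.⊓ start g) λ k → coeff f k + coeff g k

  -ᴸ_ : Laurent → Laurent
  -ᴸ f = laurent (start f) λ n → - num f n

  _-ᴸ_ : Laurent → Laurent → Laurent
  f -ᴸ g = f +ᴸ (-ᴸ g)

  _*ᴸ_ : Laurent → Laurent → Laurent
  f *ᴸ g = laurent (start f ℤ.+ start g) λ n →
    ∑[ i < suc n ] (num f (toℕ i) * num g (n ℕ.∸ toℕ i))

  laurentRawRing : RawRing c ℓ
  laurentRawRing = record
    { _≈_ = _≈ᴸ_ ; _+_ = _+ᴸ_ ; _*_ = _*ᴸ_ ; -_ = -ᴸ_ ; 0# = 0ᴸ ; 1# = 1ᴸ }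

  open import Algebra.Definitions.RawSemiring (RawRing.rawSemiring laurentRawRing) public
    using () renaming (product to productᴸ)

  Order≥ : ℤ → Laurent → Set ℓ
  Order≥ m f = ∀ k → k ℤ.< m → coeff f k ≈ 0#

  record Converges (f : ℕ → Laurent) : Set ℓ where
    field
      lower   : ℤ
      order   : ∀ n → Order≥ lower (f n)
      stage   : ℤ → ℕ
      stable  : ∀ k n → stage k ℕ.≤ n → coeff (f n) k ≈ coeff (f (stage k)) k

  limit : (f : ℕ → Laurent) → Converges f → Laurent
  limit f conv = series lower λ k → coeff (f (stage k)) k
    where open Converges conv

  -- Σ of F n over all n ∈ {0,…,N-1}^r
  boxSum : ∀ r → ℕ → (Vec ℕ r → Carrier) → Carrier
  boxSum zero    N F = F []
  boxSum (suc r) N F = ∑[ i < N ] boxSum r N (λ n → F (toℕ i ∷ n))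

  record Summable {r} (f : Vec ℕ r → Laurent) : Set ℓ where
    field
      lower   : ℤ
      order   : ∀ n → Order≥ lower (f n)
      box     : ℤ → ℕ
      outside : ∀ k n i → box k ℕ.≤ lookup n i → coeff (f n) k ≈ 0#

  infiniteSum : ∀ {r} (f : Vec ℕ r → Laurent) → Summable f → Laurent
  infiniteSum {r} f summable = series lower λ k → boxSum r (box k) λ n → coeff (f n) k
    where open Summable summable

  q^_ : ℕ → Laurent
  q^ k = 1# ·t^ (+ (2 ℕ.* k))

  poch : Laurent → ℕ → Laurent
  poch a zero    = 1ᴸ
  poch a (suc n) = poch a n *ᴸ (1ᴸ -ᴸ a *ᴸ q^ n)

  -- 1 / (1 - q^(k+1)) as a geometric series; see geometric-inverse.
  geometric : ℕ → Laurent
  geometric k = laurent 0ℤ λ n → if does (2 ℕ.* suc k ∣? n) then 1# else 0#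

  -- 1 / (q;q)_n
  1/qq : ℕ → Laurent
  1/qq zero    = 1ᴸ
  1/qq (suc n) = 1/qq n *ᴸ geometric n

  i+j-i : ∀ i j → i ℤ.+ j ℤ.- i ≡ j
  i+j-i = solve-∀

  i+[j-i] : ∀ i j → i ℤ.+ (j ℤ.- i) ≡ j
  i+[j-i] = solve-∀

  coeff-num : ∀ f n → coeff f (start f ℤ.+ + n) ≡ num f n
  coeff-num f n = cong (extend (num f)) (i+j-i (start f) (+ n))

  data Position (s k : ℤ) : Set where
    from  : ∀ n → k ≡ s ℤ.+ + n → Position s k
    below : k ℤ.< s → Position s k

  position : ∀ s k → Position s k
  position s k with k ℤ.- s in eq
  ... | + n      = from n (≡.trans (≡.sym (i+[j-i] s k)) (cong (λ x → s ℤ.+ x) eq))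
  ... | -[1+ n ] = below (shift-< s
                     (subst (ℤ._< 0ℤ) (≡.sym eq) ℤ.-<+) (arith k s) (ℤ.+-identityˡ s))
    where
    shift-< : ∀ {x y x′ y′} c → x ℤ.< y → x ℤ.+ c ≡ x′ → y ℤ.+ c ≡ y′ → x′ ℤ.< y′
    shift-< c x<y ex ey = subst₂ ℤ._<_ ex ey (ℤ.+-monoˡ-< c x<y)
    arith : ∀ k s → k ℤ.- s ℤ.+ s ≡ k
    arith = solve-∀

  coeff-below : ∀ f {k} → k ℤ.< start f → coeff f k ≡ 0#
  coeff-below f {k} k<s with k ℤ.- start f in eq
  ... | + n      = contradiction k<s (ℤ.≤⇒≯ (subst (start f ℤ.≤_)
                     (≡.trans (cong (λ x → start f ℤ.+ x) (≡.sym eq)) (i+[j-i] (start f) k))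
                     (ℤ.i≤i+j (start f) (+ n))))
  ... | -[1+ _ ] = ≡.refl

  order-num : ∀ {f m} → Order≥ m f → ∀ n → start f ℤ.+ + n ℤ.< m → num f n ≈ 0#
  order-num {f} o n lt = trans (reflexive (≡.sym (coeff-num f n))) (o _ lt)

  num-order : ∀ {f m} → (∀ n → start f ℤ.+ + n ℤ.< m → num f n ≈ 0#) → Order≥ m f
  num-order {f} o k k<m with position (start f) k
  ... | from n ≡.refl = trans (reflexive (coeff-num f n)) (o n k<m)
  ... | below k<s     = reflexive (coeff-below f k<s)

  sum-zero : ∀ {n} (g : Vector Carrier n) → (∀ i → g i ≈ 0#) → sum g ≈ 0#
  sum-zero {n} g z = trans (sum-cong-≋ {n} z) (sum-replicate-zero n)

  order-weaken : ∀ {f m m′} → m ℤ.≤ m′ → Order≥ m′ f → Order≥ m f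
  order-weaken m≤m′ o k k<m = o k (ℤ.<-≤-trans k<m m≤m′)

  order-monomial : ∀ x k → Order≥ k (x ·t^ k)
  order-monomial x k = num-order {x ·t^ k} λ n lt →
    contradiction lt (ℤ.≤⇒≯ (ℤ.i≤i+j k (+ n)))

  order-start : ∀ f {m} → m ℤ.≤ start f → Order≥ m f
  order-start f m≤s k k<m = reflexive (coeff-below f (ℤ.<-≤-trans k<m m≤s))

  order-* : ∀ {f g a b} → Order≥ a f → Order≥ b g → Order≥ (a ℤ.+ b) (f *ᴸ g)
  order-* {f} {g} {a} {b} of og = num-order {f *ᴸ g} λ n lt → sum-zero {suc n} _ (term n lt)
    where
    s = start f
    t = start g
    split : ∀ s t i j → (s ℤ.+ i) ℤ.+ (t ℤ.+ j) ≡ (s ℤ.+ t) ℤ.+ (i ℤ.+ j)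
    split = solve-∀
    term : ∀ n → s ℤ.+ t ℤ.+ + n ℤ.< a ℤ.+ b → ∀ (i : Fin (suc n)) →
           num f (toℕ i) * num g (n ℕ.∸ toℕ i) ≈ 0#
    term n lt i with s ℤ.+ + toℕ i ℤ.<? a
    ... | yes p = trans (*-congʳ (order-num {f} of _ p)) (zeroˡ _)
    ... | no ¬p with t ℤ.+ + (n ℕ.∸ toℕ i) ℤ.<? b
    ...   | yes p = trans (*-congˡ (order-num {g} og _ p)) (zeroʳ _)
    ...   | no ¬q = contradiction lt (ℤ.≤⇒≯ (subst (a ℤ.+ b ℤ.≤_)
              (≡.trans (split s t (+ toℕ i) (+ (n ℕ.∸ toℕ i)))
                (cong (λ x → s ℤ.+ t ℤ.+ + x) (ℕ.m+[n∸m]≡n (ℕ.s≤s⁻¹ (Fin.toℕ<n i)))))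
              (ℤ.+-mono-≤ (ℤ.≮⇒≥ ¬p) (ℤ.≮⇒≥ ¬q))))

  coeff-neg : ∀ f k → coeff (-ᴸ f) k ≈ - coeff f k
  coeff-neg f k with k ℤ.- start f
  ... | + n      = refl
  ... | -[1+ n ] = sym -0#≈0#

  coeff-+ : ∀ f g k → coeff (f +ᴸ g) k ≈ coeff f k + coeff g k
  coeff-+ f g k with position (start f ℤ.⊓ start g) k
  ... | from n ≡.refl = reflexive (coeff-num (f +ᴸ g) n)
  ... | below lt      = begin
    coeff (f +ᴸ g) k       ≡⟨ coeff-below (f +ᴸ g) lt ⟩
    0#                     ≈⟨ +-identityʳ 0# ⟨
    0# + 0#                ≡⟨ cong₂ _+_ (coeff-below f (ℤ.<-≤-trans lt (ℤ.i⊓j≤i _ _)))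
                                        (coeff-below g (ℤ.<-≤-trans lt (ℤ.i⊓j≤j (start f) _))) ⟨
    coeff f k + coeff g k  ∎

  order-1- : ∀ {f m} → m ℤ.≤ 0ℤ → Order≥ m f → Order≥ m (1ᴸ -ᴸ f)
  order-1- {f} {m} m≤0 o k k<m = begin
    coeff (1ᴸ -ᴸ f) k             ≈⟨ coeff-+ 1ᴸ (-ᴸ f) k ⟩
    coeff 1ᴸ k + coeff (-ᴸ f) k   ≈⟨ +-cong (order-start 1ᴸ m≤0 k k<m)
                                      (trans (coeff-neg f k) (-‿cong (o k k<m))) ⟩
    0# + - 0#                     ≈⟨ -‿inverseʳ 0# ⟩
    0#                            ∎

  sum-single : ∀ {N} (g : ℕ → Carrier) j → j ℕ.< N → (∀ i → i ℕ.< N → i ≢ j → g i ≈ 0#) →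
               ∑[ i < N ] g (toℕ i) ≈ g j
  sum-single {suc N} g zero    _           z = trans
    (+-congˡ (sum-zero {N} _ λ i → z (suc (toℕ i)) (ℕ.s≤s (Fin.toℕ<n i)) λ ())) (+-identityʳ _)
  sum-single {suc N} g (suc j) (ℕ.s≤s j<N) z = trans
    (+-cong (z 0 ℕ.z<s λ ()) (sum-single {N} (g ∘ suc) j j<N λ i i<N i≢j → z (suc i) (ℕ.s≤s i<N) (i≢j ∘ ℕ.suc-injective)))
    (+-identityˡ _)

  coeff-monomial : ∀ x k → coeff (x ·t^ k) k ≡ x
  coeff-monomial x k = cong (extend (num (x ·t^ k))) (ℤ.+-inverseʳ k)

  coeff-monomial-≢ : ∀ x k j → j ≢ k → coeff (x ·t^ k) j ≡ 0#
  coeff-monomial-≢ x k j j≢k with position k j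
  ... | below j<k           = coeff-below (x ·t^ k) j<k
  ... | from zero ≡.refl    = contradiction (ℤ.+-identityʳ k) j≢k
  ... | from (suc n) ≡.refl = coeff-num (x ·t^ k) (suc n)

  -- Multiplying by 1 + O(t^m) does not change coefficients below t^m.
  coeff-*1- : ∀ {f h m} → Order≥ 0ℤ f → Order≥ m h → ∀ k → k ℤ.< m →
              coeff (f *ᴸ (1ᴸ -ᴸ h)) k ≈ coeff f k
  coeff-*1- {f} {h} {m} of oh k k<m with position (start f ℤ.+ start (1ᴸ -ᴸ h)) k
  ... | below lt = reflexive (≡.trans (coeff-below (f *ᴸ (1ᴸ -ᴸ h)) lt) (≡.sym
          (coeff-below f (ℤ.<-≤-trans lt (subst (start f ℤ.+ u ℤ.≤_) (ℤ.+-identityʳ (start f))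
            (ℤ.+-monoʳ-≤ (start f) (ℤ.i⊓j≤i 0ℤ (start h))))))))
    where u = start (1ᴸ -ᴸ h)
  ... | from n ≡.refl = begin
    coeff (f *ᴸ (1ᴸ -ᴸ h)) k                              ≡⟨ coeff-num (f *ᴸ (1ᴸ -ᴸ h)) n ⟩
    ∑[ i < suc n ] (num f (toℕ i) * num (1ᴸ -ᴸ h) (n ℕ.∸ toℕ i))
                                                          ≈⟨ sum-cong-≋ {suc n} drop-h ⟩
    ∑[ i < suc n ] (g (toℕ i))                            ≈⟨ picked ⟩
    coeff f k                                             ∎
    where
    s = start f
    u = start (1ᴸ -ᴸ h)
    g : ℕ → Carrier
    g i = num f i * coeff 1ᴸ (u ℤ.+ + (n ℕ.∸ i))

    split : ∀ s u i j → s ℤ.+ i ℤ.+ (u ℤ.+ j) ≡ s ℤ.+ u ℤ.+ (i ℤ.+ j)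
    split = solve-∀

    drop-h : ∀ (i : Fin (suc n)) → num f (toℕ i) * num (1ᴸ -ᴸ h) (n ℕ.∸ toℕ i) ≈ g (toℕ i)
    drop-h i with s ℤ.+ + toℕ i ℤ.<? 0ℤ
    ... | yes p = trans (trans (*-congʳ z) (zeroˡ _)) (sym (trans (*-congʳ z) (zeroˡ _)))
      where z = order-num {f} of _ p
    ... | no ¬p = *-congˡ (trans
            (+-congˡ (trans (coeff-neg h e) (trans (-‿cong (oh e e<m)) -0#≈0#))) (+-identityʳ _))
      where
      e = u ℤ.+ + (n ℕ.∸ toℕ i)
      e<m : e ℤ.< m
      e<m = ℤ.≤-<-trans (subst₂ ℤ._≤_ (ℤ.+-identityˡ e)
        (≡.trans (split s u (+ toℕ i) (+ (n ℕ.∸ toℕ i)))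
          (cong (λ x → s ℤ.+ u ℤ.+ + x) (ℕ.m+[n∸m]≡n (ℕ.s≤s⁻¹ (Fin.toℕ<n i)))))
        (ℤ.+-monoˡ-≤ e (ℤ.≮⇒≥ ¬p))) k<m

    g-zero : ∀ i → u ℤ.+ + (n ℕ.∸ i) ≢ 0ℤ → g i ≈ 0#
    g-zero i ne = trans (*-congˡ (reflexive (coeff-monomial-≢ 1# 0ℤ _ ne))) (zeroʳ _)

    arith : ∀ u j → u ℤ.+ j ≡ 0ℤ → u ≡ ℤ.- j
    arith u j e = ≡.trans (ar u j) (≡.trans (cong (λ x → x ℤ.- j) e) (ℤ.+-identityˡ _))
      where ar : ∀ u j → u ≡ u ℤ.+ j ℤ.- j
            ar = solve-∀

    picked : ∑[ i < suc n ] (g (toℕ i)) ≈ coeff f k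
    picked with position s k
    ... | below k<s = trans
            (sum-zero {suc n} _ λ i → g-zero (toℕ i) λ e → contradiction k<s (ℤ.≤⇒≯
              (k≥s i e)))
            (reflexive (≡.sym (coeff-below f k<s)))
      where
      k≥s : ∀ (i : Fin (suc n)) → u ℤ.+ + (n ℕ.∸ toℕ i) ≡ 0ℤ → s ℤ.≤ k
      k≥s i e = subst (s ℤ.≤_)
        (≡.trans (≡.sym (≡.trans (cong (λ x → s ℤ.+ + toℕ i ℤ.+ x) e) (ℤ.+-identityʳ _)))
          (≡.trans (split s u (+ toℕ i) (+ (n ℕ.∸ toℕ i)))
            (cong (λ x → s ℤ.+ u ℤ.+ + x) (ℕ.m+[n∸m]≡n (ℕ.s≤s⁻¹ (Fin.toℕ<n i))))))
        (ℤ.i≤i+j s (+ toℕ i))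
    ... | from l k≡s+l = begin
            ∑[ i < suc n ] (g (toℕ i))  ≈⟨ sum-single {suc n} g l (ℕ.s≤s l≤n) off ⟩
            num f l * coeff 1ᴸ (u ℤ.+ + (n ℕ.∸ l)) ≡⟨ cong (λ x → num f l * coeff 1ᴸ x) at-l ⟩
            num f l * 1#                ≈⟨ *-identityʳ _ ⟩
            num f l                     ≡⟨ coeff-num f l ⟨
            coeff f (s ℤ.+ + l)         ≡⟨ cong (coeff f) k≡s+l ⟨
            coeff f k                   ∎
      where
      u+n≡l : u ℤ.+ + n ≡ + l
      u+n≡l = ≡.trans (ar s u (+ n)) (≡.trans (cong (λ x → x ℤ.- s) k≡s+l) (i+j-i s (+ l)))
        where ar : ∀ s u n → u ℤ.+ n ≡ s ℤ.+ u ℤ.+ n ℤ.- s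
              ar = solve-∀
      l≤n : l ℕ.≤ n
      l≤n = ℤ.drop‿+≤+ (subst₂ ℤ._≤_ u+n≡l (ℤ.+-identityˡ (+ n))
              (ℤ.+-monoˡ-≤ (+ n) (ℤ.i⊓j≤i 0ℤ (start h))))
      at : ∀ i → i ℕ.≤ n → u ℤ.+ + (n ℕ.∸ i) ≡ + l ℤ.- + i
      at i i≤n = ≡.trans (cong (λ x → u ℤ.+ x) (≡.trans (≡.sym (ℤ.⊖-≥ i≤n)) (≡.sym (ℤ.m-n≡m⊖n n i))))
        (≡.trans (≡.sym (ℤ.+-assoc u (+ n) (ℤ.- (+ i)))) (cong (λ x → x ℤ.- + i) u+n≡l))
      at-l : u ℤ.+ + (n ℕ.∸ l) ≡ 0ℤ
      at-l = ≡.trans (at l l≤n) (ℤ.+-inverseʳ (+ l))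
      off : ∀ i → i ℕ.< suc n → i ≢ l → g i ≈ 0#
      off i i<1+n i≢l = g-zero i λ e → i≢l (≡.sym (ℤ.+-injective
        (ℤ.i-j≡0⇒i≡j (+ l) (+ i) (≡.trans (≡.sym (at i (ℕ.s≤s⁻¹ i<1+n))) e))))

  ·t^-order : ∀ x n → Order≥ 0ℤ (x ·t^ (+ n))
  ·t^-order x n = order-weaken {x ·t^ (+ n)} (ℤ.+≤+ ℕ.z≤n) (order-monomial x (+ n))

  order-aq : ∀ {a m} → Order≥ m a → ∀ n → Order≥ (m ℤ.+ + (2 ℕ.* n)) (a *ᴸ q^ n)
  order-aq {a} oa n = order-* {a} {q^ n} oa (order-monomial 1# (+ (2 ℕ.* n)))

  order-factor : ∀ {a} → Order≥ 0ℤ a → ∀ n → Order≥ 0ℤ (1ᴸ -ᴸ a *ᴸ q^ n)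
  order-factor {a} oa n = order-1- {a *ᴸ q^ n} ℤ.≤-refl
    (order-weaken {a *ᴸ q^ n} (ℤ.+≤+ ℕ.z≤n) (order-aq {a} oa n))

  order-poch : ∀ {a} → Order≥ 0ℤ a → ∀ n → Order≥ 0ℤ (poch a n)
  order-poch {a} oa zero    = order-monomial 1# 0ℤ
  order-poch {a} oa (suc n) =
    order-* {poch a n} {1ᴸ -ᴸ a *ᴸ q^ n} (order-poch {a} oa n) (order-factor {a} oa n)

  -- The factors with index k ≥ n are 1 + O(t^(2n)).
  poch-converges : ∀ a → Order≥ 0ℤ a → Converges (poch a)
  poch-converges a oa = record
    { lower  = 0ℤ
    ; order  = order-poch {a} oa
    ; stage  = stage
    ; stable = λ k n k≤n → subst (λ m → coeff (poch a m) k ≈ coeff (poch a (stage k)) k)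
                             (ℕ.m∸n+n≡m k≤n) (go k (n ℕ.∸ stage k))
    }
    where
    stage : ℤ → ℕ
    stage (+ n)    = suc n
    stage -[1+ _ ] = 0

    k<stage : ∀ k → k ℤ.< + stage k
    k<stage (+ n)    = ℤ.+<+ ℕ.≤-refl
    k<stage -[1+ _ ] = ℤ.-<+

    go : ∀ k d → coeff (poch a (d ℕ.+ stage k)) k ≈ coeff (poch a (stage k)) k
    go k zero    = refl
    go k (suc d) = trans
      (coeff-*1- {poch a n} {a *ᴸ q^ n} (order-poch {a} oa n) (order-aq {a} oa n) k
        (ℤ.<-≤-trans (k<stage k) (ℤ.+≤+ (ℕ.≤-trans (ℕ.m≤n+m (stage k) d) (ℕ.m≤m+n n _)))))
      (go k d)
      where n = d ℕ.+ stage k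

  poch∞ : (a : Laurent) → Order≥ 0ℤ a → Laurent
  poch∞ a oa = limit (poch a) (poch-converges a oa)

  geometric-inverse : ∀ k → (1ᴸ -ᴸ q^ suc k) *ᴸ geometric k ≈ᴸ 1ᴸ
  geometric-inverse k -[1+ _ ] = refl
  geometric-inverse k (+ n)    = begin
    coeff ((1ᴸ -ᴸ q^ suc k) *ᴸ geometric k) (+ n)
      ≡⟨ coeff-num ((1ᴸ -ᴸ q^ suc k) *ᴸ geometric k) n ⟩
    ∑[ i < suc n ] ((δ₀ (toℕ i) + coeff (-ᴸ q^ suc k) (+ toℕ i)) * γ (n ℕ.∸ toℕ i))
      ≈⟨ sum-cong-≋ {suc n} (λ i → distribʳ (γ (n ℕ.∸ toℕ i)) (δ₀ (toℕ i)) (coeff (-ᴸ q^ suc k) (+ toℕ i))) ⟩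
    ∑[ i < suc n ] (δ₀ (toℕ i) * γ (n ℕ.∸ toℕ i)
                     + coeff (-ᴸ q^ suc k) (+ toℕ i) * γ (n ℕ.∸ toℕ i))
      ≈⟨ ∑-distrib-+ {suc n} (λ i → δ₀ (toℕ i) * γ (n ℕ.∸ toℕ i)) (h ∘ toℕ) ⟩
    ∑[ i < suc n ] (δ₀ (toℕ i) * γ (n ℕ.∸ toℕ i))
      + ∑[ i < suc n ] (h (toℕ i))
      ≈⟨ +-congʳ first ⟩
    γ n + ∑[ i < suc n ] (h (toℕ i))
      ≈⟨ second ⟩
    δ₀ n ∎
    where
    M = 2 ℕ.* suc k
    γ = num (geometric k)
    δ₀ : ℕ → Carrier
    δ₀ i = coeff 1ᴸ (+ i)
    h : ℕ → Carrier
    h i = coeff (-ᴸ q^ suc k) (+ i) * γ (n ℕ.∸ i)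

    δ₀-≢ : ∀ i → i ≢ 0 → δ₀ i ≡ 0#
    δ₀-≢ i i≢0 = coeff-monomial-≢ 1# 0ℤ (+ i) (i≢0 ∘ ℤ.+-injective)

    first : ∑[ i < suc n ] (δ₀ (toℕ i) * γ (n ℕ.∸ toℕ i)) ≈ γ n
    first = trans
      (sum-single {suc n} (λ i → δ₀ i * γ (n ℕ.∸ i)) 0 ℕ.z<s
        λ i _ i≢0 → trans (*-congʳ (reflexive (δ₀-≢ i i≢0))) (zeroˡ _))
      (*-identityˡ _)

    h-≢ : ∀ i → i ≢ M → h i ≈ 0#
    h-≢ i i≢M = trans (*-congʳ (trans (coeff-neg (q^ suc k) (+ i))
      (trans (-‿cong (reflexive (coeff-monomial-≢ 1# (+ M) (+ i) (i≢M ∘ ℤ.+-injective)))) -0#≈0#)))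
      (zeroˡ _)

    h-M : h M ≈ - γ (n ℕ.∸ M)
    h-M = trans (*-congʳ (trans (coeff-neg (q^ suc k) (+ M))
      (-‿cong (reflexive (coeff-monomial 1# (+ M)))))) (-1*x≈-x _)

    γ-∤ : ∀ {m} → ¬ (M ∣ m) → γ m ≡ 0#
    γ-∤ {m} M∤m = cong (λ b → if b then 1# else 0#) (dec-false (M ∣? m) M∤m)

    γ-∣ : ∀ {m} → M ∣ m → γ m ≡ 1#
    γ-∣ {m} M∣m = cong (λ b → if b then 1# else 0#) (dec-true (M ∣? m) M∣m)

    γ-+ : ∀ m → γ (M ℕ.+ m) ≡ γ m
    γ-+ m = helper (M ∣? m)
      where
      helper : Dec (M ∣ m) → γ (M ℕ.+ m) ≡ γ m
      helper (yes M∣m) = ≡.trans (γ-∣ (∣m∣n⇒∣m+n ∣-refl M∣m)) (≡.sym (γ-∣ M∣m))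
      helper (no  M∤m) = ≡.trans (γ-∤ λ M∣M+m → M∤m (∣m+n∣m⇒∣n M∣M+m ∣-refl)) (≡.sym (γ-∤ M∤m))

    second : γ n + ∑[ i < suc n ] (h (toℕ i)) ≈ δ₀ n
    second with M ℕ.≤? n
    ... | yes M≤n = begin
      γ n + ∑[ i < suc n ] (h (toℕ i))
        ≈⟨ +-congˡ (sum-single {suc n} h M (ℕ.s≤s M≤n) λ i _ → h-≢ i) ⟩
      γ n + h M
        ≈⟨ +-cong (reflexive (≡.trans (cong γ (≡.sym (ℕ.m+[n∸m]≡n M≤n))) (γ-+ (n ℕ.∸ M)))) h-M ⟩
      γ (n ℕ.∸ M) + - γ (n ℕ.∸ M)
        ≈⟨ -‿inverseʳ _ ⟩
      0#
        ≡⟨ δ₀-≢ n (λ n≡0 → contradiction (subst (M ℕ.≤_) n≡0 M≤n) λ ()) ⟨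
      δ₀ n ∎
    ... | no M≰n = trans
      (+-congˡ (sum-zero {suc n} _ λ i → h-≢ (toℕ i) λ i≡M →
        M≰n (subst (ℕ._≤ n) i≡M (ℕ.s≤s⁻¹ (Fin.toℕ<n i)))))
      (trans (+-identityʳ _) (small n (ℕ.≰⇒> M≰n)))
      where
      small : ∀ m → m ℕ.< M → γ m ≈ δ₀ m
      small zero    _   = reflexive (γ-∣ (M ∣0))
      small (suc m) m<M = reflexive (≡.trans
        (γ-∤ λ M∣m → ℕ.<⇒≱ m<M (∣⇒≤ M∣m)) (≡.sym (δ₀-≢ (suc m) λ ())))

  monomial : ∀ {r} → Vector Carrier r → Vec ℕ r → Carrier
  monomial x n = product λ i → x i ^ lookup n i

  -- The summation index n runs over ℕ^r: the terms with some n_i < 0 vanish by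
  -- the convention 1/(q;q)_m = 0 for m < 0.  As q^{1/2} = t, the exponent of t is
  -- the quadratic form without the factor 1/2.
  𝒯-term : ∀ {r} → Vector Carrier r → Vec ℕ r → Laurent
  𝒯-term {r} x n =
    monomial x n ·t^ quad (tadpole r) n *ᴸ productᴸ (λ i → 1/qq (lookup n i))

  -- (-z q^{1/2-n_r};q)_{n_r} with -z q^{1/2-n_r} = (-z) t^{1-2n_r}; n_r exists as r ≥ 1.
  𝒜-term : ∀ {r} → Vector Carrier (suc r) → Carrier → Vec ℕ (suc r) → Laurent
  𝒜-term {r} x z n =
    monomial x n ·t^ quad (cartanA (suc r)) n
      *ᴸ poch ((- z) ·t^ (1ℤ ℤ.- + (2 ℕ.* last n))) (last n)
      *ᴸ productᴸ (λ i → 1/qq (lookup n i))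

  order-1/qq : ∀ n → Order≥ 0ℤ (1/qq n)
  order-1/qq zero    = order-monomial 1# 0ℤ
  order-1/qq (suc n) = order-* {1/qq n} {geometric n} (order-1/qq n)
                         (order-start (geometric n) ℤ.≤-refl)

  order-product : ∀ {r} (f : Vector Laurent r) → (∀ i → Order≥ 0ℤ (f i)) → Order≥ 0ℤ (productᴸ f)
  order-product {zero}  f o = order-monomial 1# 0ℤ
  order-product {suc r} f o = order-* {f zero} {productᴸ (f ∘ suc)} (o zero)
                                (order-product (f ∘ suc) (o ∘ suc))

  order-𝒯 : ∀ {r} (x : Vector Carrier r) n → Order≥ (quad (tadpole r) n) (𝒯-term x n)
  order-𝒯 {r} x n = subst (λ m → Order≥ m (𝒯-term x n)) (ℤ.+-identityʳ _)
    (order-* {monomial x n ·t^ quad (tadpole r) n} (order-monomial _ _)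
      (order-product (λ i → 1/qq (lookup n i)) λ i → order-1/qq (lookup n i)))

  -- The factors of (a;q)_l with a = O(t^(1-2l)) have order ≥ 1-2l, 3-2l, …, -1.
  order-poch-neg : ∀ {a} l → Order≥ (1ℤ ℤ.- + (2 ℕ.* l)) a → ∀ n → n ℕ.≤ l →
                   Order≥ (+ n ℤ.* + n ℤ.- + (2 ℕ.* l) ℤ.* + n) (poch a n)
  order-poch-neg {a} l oa zero    _   = order-start 1ᴸ (ℤ.≤-reflexive (e (+ (2 ℕ.* l))))
    where e : ∀ l → 0ℤ ℤ.* 0ℤ ℤ.- l ℤ.* 0ℤ ≡ 0ℤ
          e = solve-∀
  order-poch-neg {a} l oa (suc n) n<l = subst (λ m → Order≥ m (poch a (suc n)))
    (≡.trans (cong (λ x → (+ n ℤ.* + n ℤ.- L ℤ.* + n) ℤ.+ (1ℤ ℤ.- L ℤ.+ x)) (ℤ.pos-* 2 n)) (arith (+ n) L))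
    (order-* {poch a n} {1ᴸ -ᴸ a *ᴸ q^ n} (order-poch-neg {a} l oa n (ℕ.<⇒≤ n<l))
      (order-1- {a *ᴸ q^ n} neg (order-aq {a} oa n)))
    where
    L = + (2 ℕ.* l)
    arith : ∀ n L → (n ℤ.* n ℤ.- L ℤ.* n) ℤ.+ (1ℤ ℤ.- L ℤ.+ + 2 ℤ.* n)
            ≡ (1ℤ ℤ.+ n) ℤ.* (1ℤ ℤ.+ n) ℤ.- L ℤ.* (1ℤ ℤ.+ n)
    arith = solve-∀
    neg : 1ℤ ℤ.- L ℤ.+ + (2 ℕ.* n) ℤ.≤ 0ℤ
    neg = shift-≤ (ℤ.- L) (ℤ.+≤+ (ℕ.≤-trans (ℕ.n≤1+n _)
            (ℕ.≤-trans (ℕ.≤-reflexive (≡.sym (ℕ.*-suc 2 n))) (ℕ.*-monoʳ-≤ 2 n<l))))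
            (e (+ (2 ℕ.* n)) L) (ℤ.+-inverseʳ L)
      where e : ∀ n L → (1ℤ ℤ.+ n) ℤ.+ ℤ.- L ≡ 1ℤ ℤ.- L ℤ.+ n
            e = solve-∀

  order-𝒜 : ∀ {r} (x : Vector Carrier (suc r)) z n →
             Order≥ (quad (tadpole (suc r)) n) (𝒜-term x z n)
  order-𝒜 {r} x z n = subst (λ m → Order≥ m (𝒜-term x z n)) orders
    (order-* {mon *ᴸ P}
      (order-* {mon} (order-monomial _ _)
        (order-poch-neg l (order-monomial (- z) _) l ℕ.≤-refl))
      (order-product (λ i → 1/qq (lookup n i)) λ i → order-1/qq (lookup n i)))
    where
    l = last n
    mon = monomial x n ·t^ quad (cartanA (suc r)) n
    P = poch ((- z) ·t^ (1ℤ ℤ.- + (2 ℕ.* l))) l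
    arith : ∀ T l → T ℤ.+ l ℤ.* l ℤ.+ (l ℤ.* l ℤ.- + 2 ℤ.* l ℤ.* l) ℤ.+ 0ℤ ≡ T
    arith = solve-∀
    orders : quad (cartanA (suc r)) n ℤ.+ (+ l ℤ.* + l ℤ.- + (2 ℕ.* l) ℤ.* + l) ℤ.+ 0ℤ
             ≡ quad (tadpole (suc r)) n
    orders = ≡.trans
      (cong₂ (λ x y → x ℤ.+ (+ l ℤ.* + l ℤ.- y ℤ.* + l) ℤ.+ 0ℤ) (cartanA-tadpole n) (ℤ.pos-* 2 l))
      (arith _ (+ l))

  summable : ∀ {r} (f : Vec ℕ r → Laurent) →
             (∀ n → Order≥ (quad (tadpole r) n) (f n)) → Summable f
  summable {r} f o = record
    { lower   = 0ℤ
    ; order   = λ n → order-weaken {f n} (tadpole-nonneg n) (o n)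
    ; box     = box
    ; outside = λ k n i k≤n → o n k (outside k n i k≤n)
    }
    where
    box : ℤ → ℕ
    box (+ k)    = suc k
    box -[1+ _ ] = 0

    outside : ∀ k (n : Vec ℕ r) i → box k ℕ.≤ lookup n i → k ℤ.< quad (tadpole r) n
    outside (+ k)    n i k≤n = ℤ.<-≤-trans (ℤ.+<+ k≤n) (tadpole-bound n i)
    outside -[1+ _ ] n i _   = ℤ.<-≤-trans ℤ.-<+ (tadpole-nonneg n)

  𝒯-summable : ∀ {r} (x : Vector Carrier r) → Summable (𝒯-term x)
  𝒯-summable x = summable (𝒯-term x) (order-𝒯 x)

  𝒜-summable : ∀ {r} (x : Vector Carrier (suc r)) z → Summable (𝒜-term x z)
  𝒜-summable x z = summable (𝒜-term x z) (order-𝒜 x z)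

  𝒯 : ∀ {r} → Vector Carrier r → Laurent
  𝒯 x = infiniteSum (𝒯-term x) (𝒯-summable x)

  𝒜 : ∀ {r} → Vector Carrier (suc r) → Carrier → Laurent
  𝒜 x z = infiniteSum (𝒜-term x z) (𝒜-summable x z)

{-# OPTIONS --safe #-}
module Submission where

-- Write z = x_{r+1} and let l be the last entry of n = (n_1,…,n_r).  Splitting off the last
-- summation index j of 𝒯_{r+1}, the quadratic form becomes n A_r nᵀ + j² - 2lj, so the sum over j
-- is Σ_j q^{j²/2 - lj} z^j / (q;q)_j, which by Euler's identity equals
-- (-z q^{1/2-l};q)_∞ = (-z q^{1/2-l};q)_l (-z q^{1/2};q)_∞.  To compare the coefficients of t^k
-- Euler's identity may be replaced by its finite form, the q-binomial theorem for
-- (-z q^{1/2-l};q)_N with N = l + k + 1: the factor (q;q)_N / (q;q)_{N-j} by which its j-th term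
-- differs from Euler's is 1 + O(t^{2(N+1-j)}), and the summand of 𝒯_{r+1} with last index j has
-- order at least j.

open import Defs
open import Algebra.Bundles using (CommutativeRing; Monoid)
import Algebra.Consequences.Setoid as Consequences
open import Data.Fin.Base using (Fin; toℕ; zero; suc; fromℕ; inject₁)
import Data.Fin.Properties as Fin
open import Data.Integer.Base as ℤ using (ℤ; +_; -[1+_]; 0ℤ; 1ℤ)
import Data.Integer.Properties as ℤ
open import Data.Integer.Tactic.RingSolver using (solve-∀)
open import Data.Nat.Base as ℕ using (ℕ; zero; suc)
import Data.Nat.Properties as ℕ
open import Data.Vec.Base as Vec using (Vec; []; _∷_; _∷ʳ_; lookup)
open import Data.Vec.Functional using (Vector; init; last)
open import Function.Base using (_∘_)
open import Relation.Binary.Bundles using (Setoid)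
import Relation.Binary.Reasoning.Setoid as SetoidReasoning
open import Relation.Binary.PropositionalEquality as ≡ using (_≡_; cong; subst)

-- Appending an index: the quadratic form

lookup-∷ʳ-inject₁ : ∀ {a} {A : Set a} {n} (v : Vec A n) x i → lookup (v ∷ʳ x) (inject₁ i) ≡ lookup v i
lookup-∷ʳ-inject₁ (y ∷ v) x zero    = ≡.refl
lookup-∷ʳ-inject₁ (y ∷ v) x (suc i) = lookup-∷ʳ-inject₁ v x i

lookup-∷ʳ-fromℕ : ∀ {a} {A : Set a} {n} (v : Vec A n) x → lookup (v ∷ʳ x) (fromℕ n) ≡ x
lookup-∷ʳ-fromℕ []      x = ≡.refl
lookup-∷ʳ-fromℕ (y ∷ v) x = lookup-∷ʳ-fromℕ v x

-- Induction from the front: `tadpole-cons` and `cartanA-cons` peel off the same contribution, so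
-- the two matrices only differ in the base case. There the former last entry is no longer last, and
-- its diagonal entry is the 2 of the Cartan matrix.
tadpole-∷ʳ : ∀ {r} (n : Vec ℕ (suc r)) j → quad (tadpole _) (n ∷ʳ j) ≡
  quad (cartanA _) n ℤ.+ (+ j ℤ.* + j ℤ.- + 2 ℤ.* (+ Vec.last n ℤ.* + j))
tadpole-∷ʳ (a ∷ []) j = ≡.trans (tadpole-cons a j []) (arith (+ a) (+ j))
  where
  arith : ∀ a j →
    (+ 2 ℤ.* (a ℤ.* a) ℤ.- + 2 ℤ.* (a ℤ.* j)) ℤ.+ (j ℤ.* + 1 ℤ.* j ℤ.+ 0ℤ ℤ.+ 0ℤ)
    ≡ (a ℤ.* + 2 ℤ.* a ℤ.+ 0ℤ ℤ.+ 0ℤ) ℤ.+ (j ℤ.* j ℤ.- + 2 ℤ.* (a ℤ.* j))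
  arith = solve-∀
tadpole-∷ʳ (a ∷ b ∷ w) j = begin
  quad (tadpole _) (a ∷ b ∷ (w ∷ʳ j))            ≡⟨ tadpole-cons a b (w ∷ʳ j) ⟩
  c ℤ.+ quad (tadpole _) ((b ∷ w) ∷ʳ j)          ≡⟨ cong (λ x → c ℤ.+ x) (tadpole-∷ʳ (b ∷ w) j) ⟩
  c ℤ.+ (quad (cartanA _) (b ∷ w) ℤ.+ e)         ≡⟨ ℤ.+-assoc c _ e ⟨
  c ℤ.+ quad (cartanA _) (b ∷ w) ℤ.+ e           ≡⟨ cong (ℤ._+ e) (cartanA-cons a b w) ⟨
  quad (cartanA _) (a ∷ b ∷ w) ℤ.+ e             ∎
  where
  open ≡.≡-Reasoning
  c = + 2 ℤ.* (+ a ℤ.* + a) ℤ.- + 2 ℤ.* (+ a ℤ.* + b)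
  e = + j ℤ.* + j ℤ.- + 2 ℤ.* (+ Vec.last (b ∷ w) ℤ.* + j)

-- Finite sums in a monoid

module MonoidSums {c ℓ} (M : Monoid c ℓ) where
  open Monoid M
  open import Algebra.Properties.Monoid.Sum M

  sum-truncate : ∀ {a b} (f : ℕ → Carrier) → a ℕ.≤ b → (∀ i → a ℕ.≤ i → f i ≈ ε) →
                 ∑[ i < b ] f (toℕ i) ≈ ∑[ i < a ] f (toℕ i)
  sum-truncate {b = b} f ℕ.z≤n z =
    trans (sum-cong-≋ {b} λ i → z (toℕ i) ℕ.z≤n) (sum-replicate-zero b)
  sum-truncate f (ℕ.s≤s a≤b) z =
    ∙-congˡ (sum-truncate (f ∘ suc) a≤b λ i a≤i → z (suc i) (ℕ.s≤s a≤i))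

  -- In multiplicative monoids this splits off the last factor of the monomial in x and of the
  -- product of the 1/(q;q).
  sum-∷ʳ : ∀ {r} (f : Fin (suc r) → ℕ → Carrier) (n : Vec ℕ r) j →
           sum (λ i → f i (lookup (n ∷ʳ j) i)) ≈ sum (λ i → f (inject₁ i) (lookup n i)) ∙ f (fromℕ r) j
  sum-∷ʳ {r} f n j = trans (sum-init-last (λ i → f i (lookup (n ∷ʳ j) i)))
    (∙-cong (reflexive (sum-cong-≗ λ i → cong (f (inject₁ i)) (lookup-∷ʳ-inject₁ n j i)))
            (reflexive (cong (f (fromℕ r)) (lookup-∷ʳ-fromℕ n j))))

-- The q-binomial theorem in a commutative ring

module _ {c ℓ} (S : CommutativeRing c ℓ) where
  open CommutativeRing S

  -- q n and r n stand for q^n and 1/(q;q)_n.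
  module QBinomial
    (q : ℕ → Carrier) (q-zero : q 0 ≈ 1#) (q-suc : ∀ n → q (suc n) ≈ q 1 * q n)
    (r : ℕ → Carrier) (r-zero : r 0 ≈ 1#) (r-suc : ∀ n → (1# - q (suc n)) * r (suc n) ≈ r n)
    where

    open import Algebra.Properties.Ring ring
      using (-‿distribˡ-*; [y-z]x≈yx-zx; x[y-z]≈xy-xz)
    open import Algebra.Properties.Semiring.Sum semiring
      using (sum-syntax; sum-cong-≋; *-distribˡ-sum; ∑-distrib-+)
    open import Algebra.Solver.Ring.NaturalCoefficients.Default commutativeSemiring
    open import Relation.Binary.Reasoning.Setoid setoid
    open MonoidSums +-monoid using (sum-truncate)

    -- ∏_{i<k} (1 - q^{n-i}) = (q;q)_n / (q;q)_{n-k}, which vanishes for k > n.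
    falling : ℕ → ℕ → Carrier
    falling n       zero    = 1#
    falling zero    (suc k) = 0#
    falling (suc n) (suc k) = (1# - q (suc n)) * falling n k

    falling-zero : ∀ {n k} → n ℕ.< k → falling n k ≈ 0#
    falling-zero {zero}  {suc k} _           = refl
    falling-zero {suc n} {suc k} (ℕ.s≤s n<k) = trans (*-congˡ (falling-zero n<k)) (zeroʳ _)

    -- Passing from (n, k) to (n+1, k+1) changes the distance from 1 only by a multiple of q^{n+1};
    -- the order estimate `order-falling-1` rests on this.
    falling-suc-1 : ∀ n k → falling (suc n) (suc k) - 1# ≈ (falling n k - 1#) - q (suc n) * falling n k
    falling-suc-1 n k = begin
      (1# - q (suc n)) * φ - 1#       ≈⟨ +-congʳ ([y-z]x≈yx-zx _ _ _) ⟩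
      -- The solver is one for commutative semirings, so negated terms enter it as atoms.
      (1# * φ - q (suc n) * φ) - 1#   ≈⟨ solve 3 (λ f x y → (con 1 :* f :+ x) :+ y := (f :+ y) :+ x)
           refl φ (- (q (suc n) * φ)) (- 1#) ⟩
      (φ - 1#) - q (suc n) * φ        ∎
      where φ = falling n k

    -- The recursion falling n (k+1) = falling n k (1 - q^{n-k}), multiplied by q^k so that
    -- no negative power of q occurs when n < k.
    falling-suc : ∀ n k → q k * falling n (suc k) ≈ falling n k * (q k - q n)
    falling-suc zero zero = begin
      q 0 * 0#          ≈⟨ zeroʳ _ ⟩
      0#                ≈⟨ -‿inverseʳ _ ⟨
      q 0 - q 0         ≈⟨ *-identityˡ _ ⟨
      1# * (q 0 - q 0)  ∎
    falling-suc zero (suc k) = trans (zeroʳ _) (sym (zeroˡ _))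
    falling-suc (suc n) zero = begin
      q 0 * ((1# - q (suc n)) * 1#)  ≈⟨ *-cong q-zero (trans (*-identityʳ _) (+-congʳ (sym q-zero))) ⟩
      1# * (q 0 - q (suc n))         ∎
    falling-suc (suc n) (suc k) = begin
      q (suc k) * (A * falling n (suc k))
        ≈⟨ *-congʳ (q-suc k) ⟩
      q 1 * q k * (A * falling n (suc k))
        ≈⟨ solve 4 (λ x y z w → x :* y :* (z :* w) := z :* x :* (y :* w))
             refl (q 1) (q k) A (falling n (suc k)) ⟩
      A * q 1 * (q k * falling n (suc k))
        ≈⟨ *-congˡ (falling-suc n k) ⟩
      A * q 1 * (falling n k * (q k - q n))
        ≈⟨ solve 4 (λ x y z w → x :* y :* (z :* w) := x :* z :* (y :* w))
             refl A (q 1) (falling n k) (q k - q n) ⟩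
      A * falling n k * (q 1 * (q k - q n))
        ≈⟨ *-congˡ (trans (x[y-z]≈xy-xz _ _ _) (+-cong (sym (q-suc k)) (-‿cong (sym (q-suc n))))) ⟩
      A * falling n k * (q (suc k) - q (suc n)) ∎
      where A = 1# - q (suc n)

    telescope : ∀ x y z → (x - y) + (y - z) ≈ x - z
    telescope x y z = begin
      (x - y) + (y - z)   ≈⟨ solve 4 (λ x y y′ z → (x :+ y′) :+ (y :+ z) := (x :+ z) :+ (y :+ y′))
           refl x y (- y) (- z) ⟩
      (x - z) + (y - y)   ≈⟨ +-congˡ (-‿inverseʳ y) ⟩
      (x - z) + 0#        ≈⟨ +-identityʳ _ ⟩
      x - z ∎

    -- p n and e k stand for (a;q)_n and (-a)^k q^{k(k-1)/2}.
    module _ (a : Carrier)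
      (p : ℕ → Carrier) (p-zero : p 0 ≈ 1#) (p-suc : ∀ n → p (suc n) ≈ p n * (1# - a * q n))
      (e : ℕ → Carrier) (e-zero : e 0 ≈ 1#) (e-suc : ∀ k → e (suc k) ≈ e k * (- a * q k))
      where

      -- The factor `falling n k * r k` is the Gaussian binomial coefficient, (q;q)_n / (q;q)_{n-k}
      -- times 1/(q;q)_k; in this form it makes sense for all n and k.
      term : ℕ → ℕ → Carrier
      term n k = e k * (falling n k * r k)

      term-zero : ∀ n → term n 0 ≈ 1#
      term-zero n = trans (*-cong e-zero (trans (*-identityˡ _) r-zero)) (*-identityˡ _)

      -- The q-Pascal rule, whose factor q^{n-k} becomes q^n because `e (suc k)` contributes q^k. It
      -- comes from q^k (1 - q^{n+1}) = (q^k - q^n) + q^n (1 - q^{k+1}): the first part extends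
      -- `falling n k` by one factor, the second cancels the last factor of 1/(q;q)_{k+1}.
      term-suc : ∀ n k → term (suc n) (suc k) ≈ term n (suc k) + - a * q n * term n k
      term-suc n k = begin
        e (suc k) * ((1# - q (suc n)) * φ * r′)
          ≈⟨ *-congʳ (e-suc k) ⟩
        e k * (- a * q k) * ((1# - q (suc n)) * φ * r′)
          ≈⟨ solve 6 (λ e a x y f r → e :* (a :* x) :* (y :* f :* r) := e :* a :* f :* r :* (x :* y))
               refl (e k) (- a) (q k) (1# - q (suc n)) φ r′ ⟩
        F * (q k * (1# - q (suc n)))
          ≈⟨ *-congˡ split ⟩
        F * ((q k - q n) + q n * (1# - q (suc k)))
          ≈⟨ solve 7 (λ e a f r x y z → e :* a :* f :* r :* (x :+ y :* z) :=
                              e :* a :* (f :* x) :* r :+ a :* y :* (e :* (f :* (z :* r))))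
               refl (e k) (- a) φ r′ (q k - q n) (q n) (1# - q (suc k)) ⟩
        e k * - a * (φ * (q k - q n)) * r′ + - a * q n * (e k * (φ * ((1# - q (suc k)) * r′)))
          ≈⟨ +-cong (*-congʳ (*-congˡ (sym (falling-suc n k)))) (*-congˡ (*-congˡ (*-congˡ (r-suc k)))) ⟩
        e k * - a * (q k * falling n (suc k)) * r′ + - a * q n * term n k
          ≈⟨ +-congʳ (solve 5 (λ e a x f r → e :* a :* (x :* f) :* r := e :* (a :* x) :* (f :* r))
               refl (e k) (- a) (q k) (falling n (suc k)) r′) ⟩
        e k * (- a * q k) * (falling n (suc k) * r′) + - a * q n * term n k
          ≈⟨ +-congʳ (*-congʳ (sym (e-suc k))) ⟩
        term n (suc k) + - a * q n * term n k ∎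
        where
        φ = falling n k
        r′ = r (suc k)
        F = e k * - a * φ * r′

        expand : ∀ x y → x * (1# - y) ≈ x - x * y
        expand x y = trans (x[y-z]≈xy-xz x 1# y) (+-congʳ (*-identityʳ x))

        swap : q n * q (suc k) ≈ q k * q (suc n)
        swap = trans (*-congˡ (q-suc k)) (trans
          (solve 3 (λ x y z → x :* (y :* z) := z :* (y :* x)) refl (q n) (q 1) (q k))
          (*-congˡ (sym (q-suc n))))

        split : q k * (1# - q (suc n)) ≈ (q k - q n) + q n * (1# - q (suc k))
        split = begin
          q k * (1# - q (suc n))                 ≈⟨ expand _ _ ⟩
          q k - q k * q (suc n)                  ≈⟨ telescope _ (q n) _ ⟨
          (q k - q n) + (q n - q k * q (suc n))  ≈⟨ +-congˡ (+-congˡ (-‿cong swap)) ⟨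
          (q k - q n) + (q n - q n * q (suc k))  ≈⟨ +-congˡ (expand _ _) ⟨
          (q k - q n) + q n * (1# - q (suc k))   ∎

      q-binomial : ∀ n → p n ≈ ∑[ k < suc n ] term n (toℕ k)
      q-binomial zero = begin
        p 0            ≈⟨ p-zero ⟩
        1#             ≈⟨ term-zero 0 ⟨
        term 0 0       ≈⟨ +-identityʳ _ ⟨
        term 0 0 + 0#  ∎
      q-binomial (suc n) = begin
        p (suc n)
          ≈⟨ p-suc n ⟩
        p n * (1# - a * q n)
          ≈⟨ *-cong (q-binomial n) (+-congˡ (-‿distribˡ-* a (q n))) ⟩
        s * (1# + - a * q n)
          ≈⟨ solve 2 (λ s x → s :* (con 1 :+ x) := s :+ x :* s) refl s (- a * q n) ⟩
        s + - a * q n * s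
          -- The first sum is extended by its vanishing term of index n+1. Without its term of index
          -- 0 it then has as many terms as the second sum, and `term-suc` applies pairwise.
          ≈⟨ +-congʳ (sum-truncate (term n) (ℕ.n≤1+n (suc n)) λ i n<i →
               trans (*-congˡ (trans (*-congʳ (falling-zero n<i)) (zeroˡ _))) (zeroʳ _)) ⟨
        (term n 0 + ∑[ k < suc n ] term n (suc (toℕ k))) + - a * q n * s
          ≈⟨ +-assoc _ _ _ ⟩
        term n 0 + (∑[ k < suc n ] term n (suc (toℕ k)) + - a * q n * s)
          ≈⟨ +-cong (trans (term-zero n) (sym (term-zero (suc n))))
               (+-congˡ (*-distribˡ-sum {suc n} (- a * q n) (term n ∘ toℕ))) ⟩
        term (suc n) 0 + (∑[ k < suc n ] term n (suc (toℕ k)) + ∑[ k < suc n ] (- a * q n * term n (toℕ k)))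
          ≈⟨ +-congˡ (∑-distrib-+ {suc n} (λ k → term n (suc (toℕ k))) (λ k → - a * q n * term n (toℕ k))) ⟨
        term (suc n) 0 + ∑[ k < suc n ] (term n (suc (toℕ k)) + - a * q n * term n (toℕ k))
          ≈⟨ +-congˡ (sum-cong-≋ {suc n} λ k → sym (term-suc n (toℕ k))) ⟩
        term (suc n) 0 + ∑[ k < suc n ] term (suc n) (suc (toℕ k)) ∎
        where s = ∑[ k < suc n ] term n (toℕ k)

-- Sums over boxes of index vectors

module BoxSums {c ℓ} (R : CommutativeRing c ℓ) where
  open CommutativeRing R hiding (zero)
  open FormalSeries R
  open import Algebra.Properties.Semiring.Sum semiring using (sum-cong-≋; *-distribˡ-sum)
  open MonoidSums +-monoid using (sum-truncate)

  boxSum-cong : ∀ r N {F G : Vec ℕ r → Carrier} → (∀ n → F n ≈ G n) → boxSum r N F ≈ boxSum r N G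
  boxSum-cong zero    N F≈G = F≈G []
  boxSum-cong (suc r) N F≈G = sum-cong-≋ {N} λ i → boxSum-cong r N λ n → F≈G (toℕ i ∷ n)

  boxSum-zero : ∀ r N {F : Vec ℕ r → Carrier} → (∀ n → F n ≈ 0#) → boxSum r N F ≈ 0#
  boxSum-zero zero    N F≈0 = F≈0 []
  boxSum-zero (suc r) N F≈0 = sum-zero {N} _ λ i → boxSum-zero r N λ n → F≈0 (toℕ i ∷ n)

  -- The last index is already the innermost summation variable of `boxSum`, so no sums need to be
  -- interchanged.
  boxSum-∷ʳ : ∀ r N (F : Vec ℕ (suc r) → Carrier) →
              boxSum (suc r) N F ≈ boxSum r N λ n → ∑[ j < N ] F (n ∷ʳ toℕ j)
  boxSum-∷ʳ zero    N F = refl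
  boxSum-∷ʳ (suc r) N F = sum-cong-≋ {N} λ i → boxSum-∷ʳ r N λ n → F (toℕ i ∷ n)

  boxSum-*ˡ : ∀ r N x (F : Vec ℕ r → Carrier) → x * boxSum r N F ≈ boxSum r N λ n → x * F n
  boxSum-*ˡ zero    N x F = refl
  boxSum-*ˡ (suc r) N x F = trans
    (*-distribˡ-sum {N} x λ i → boxSum r N λ n → F (toℕ i ∷ n))
    (sum-cong-≋ {N} λ i → boxSum-*ˡ r N x λ n → F (toℕ i ∷ n))

  boxSum-truncate : ∀ r {M N} (F : Vec ℕ r → Carrier) → M ℕ.≤ N →
                    (∀ n i → M ℕ.≤ lookup n i → F n ≈ 0#) → boxSum r N F ≈ boxSum r M F
  boxSum-truncate zero            F M≤N z = refl
  boxSum-truncate (suc r) {M} {N} F M≤N z = trans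
    (sum-cong-≋ {N} λ i → boxSum-truncate r (λ n → F (toℕ i ∷ n)) M≤N λ n i′ → z (toℕ i ∷ n) (suc i′))
    (sum-truncate (λ i → boxSum r M λ n → F (i ∷ n)) M≤N λ i M≤i →
      boxSum-zero r M λ n → z (i ∷ n) zero M≤i)

-- The commutative ring of formal Laurent series

module LaurentRing {c ℓ} (R : CommutativeRing c ℓ) where
  open CommutativeRing R hiding (zero)
  open FormalSeries R
  open import Algebra.Properties.Semiring.Sum semiring using (sum-cong-≋)
  open import Algebra.Solver.Ring.NaturalCoefficients.Default commutativeSemiring
    using (solve; _:=_; _:+_; _:*_)
  open import Relation.Binary.Reasoning.Setoid setoid hiding (start)

  infixl 7 _⊛_
  infix  4 _≐_

  -- The Cauchy product of power series; `num (f *ᴸ g)` is `num f ⊛ num g` by definition.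
  _⊛_ : (ℕ → Carrier) → (ℕ → Carrier) → ℕ → Carrier
  (a ⊛ b) n = ∑[ i < suc n ] (a (toℕ i) * b (n ℕ.∸ toℕ i))

  _≐_ : (ℕ → Carrier) → (ℕ → Carrier) → Set ℓ
  a ≐ b = ∀ n → a n ≈ b n

  ⊛-cong : ∀ {a a′ b b′} → a ≐ a′ → b ≐ b′ → a ⊛ b ≐ a′ ⊛ b′
  ⊛-cong a≐ b≐ n = sum-cong-≋ {suc n} λ i → *-cong (a≐ (toℕ i)) (b≐ (n ℕ.∸ toℕ i))

  -- As in the laws below, induction on n works because `(a ⊛ b) (suc n)` computes to
  -- `a 0 * b (suc n) + ((a ∘ suc) ⊛ b) n`; the left factors are shifted in the induction
  -- hypothesis.
  ⊛-distribʳ : ∀ a b c → (λ n → b n + c n) ⊛ a ≐ λ n → (b ⊛ a) n + (c ⊛ a) n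
  ⊛-distribʳ a b c zero    = trans (+-congˡ (sym (+-identityʳ 0#)))
    (solve 4 (λ a b c z → (b :+ c) :* a :+ (z :+ z) := b :* a :+ z :+ (c :* a :+ z))
         refl (a 0) (b 0) (c 0) 0#)
  ⊛-distribʳ a b c (suc n) = trans (+-congˡ (⊛-distribʳ a (b ∘ suc) (c ∘ suc) n))
    (solve 5 (λ a b c x y → (b :+ c) :* a :+ (x :+ y) := b :* a :+ x :+ (c :* a :+ y)) refl
      (a (suc n)) (b 0) (c 0) (((b ∘ suc) ⊛ a) n) (((c ∘ suc) ⊛ a) n))

  ⊛-scale : ∀ x a b → (λ n → x * a n) ⊛ b ≐ λ n → x * (a ⊛ b) n
  ⊛-scale x a b zero    = trans (+-cong (*-assoc _ _ _) (sym (zeroʳ x))) (sym (distribˡ x _ 0#))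
  ⊛-scale x a b (suc n) = trans (+-cong (*-assoc _ _ _) (⊛-scale x (a ∘ suc) b n)) (sym (distribˡ x _ _))

  ⊛-assoc : ∀ a b c → (a ⊛ b) ⊛ c ≐ a ⊛ (b ⊛ c)
  ⊛-assoc a b c zero    = +-congʳ (trans (*-congʳ (+-identityʳ _))
    (trans (*-assoc _ _ _) (*-congˡ (sym (+-identityʳ _)))))
  ⊛-assoc a b c (suc n) = begin
    -- The shifted left factor `(a ⊛ b) ∘ suc` is itself a sum of two sequences, so distributivity
    -- comes before the induction hypothesis.
    (a 0 * b 0 + 0#) * c (suc n) + ((λ i → a 0 * b (suc i) + ((a ∘ suc) ⊛ b) i) ⊛ c) n
      ≈⟨ +-cong (*-congʳ (+-identityʳ _)) (⊛-distribʳ c (λ i → a 0 * b (suc i)) ((a ∘ suc) ⊛ b) n) ⟩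
    a 0 * b 0 * c (suc n) + (((λ i → a 0 * b (suc i)) ⊛ c) n + (((a ∘ suc) ⊛ b) ⊛ c) n)
      ≈⟨ +-congˡ (+-cong (⊛-scale (a 0) (b ∘ suc) c n) (⊛-assoc (a ∘ suc) b c n)) ⟩
    a 0 * b 0 * c (suc n) + (a 0 * ((b ∘ suc) ⊛ c) n + ((a ∘ suc) ⊛ (b ⊛ c)) n)
      ≈⟨ solve 5 (λ a b c x y → a :* b :* c :+ (a :* x :+ y) := a :* (b :* c :+ x) :+ y) refl
           (a 0) (b 0) (c (suc n)) (((b ∘ suc) ⊛ c) n) (((a ∘ suc) ⊛ (b ⊛ c)) n) ⟩
    a 0 * (b ⊛ c) (suc n) + ((a ∘ suc) ⊛ (b ⊛ c)) n ∎

  ⊛-zeroˡ : ∀ {a} b → (∀ n → a n ≈ 0#) → ∀ n → (a ⊛ b) n ≈ 0#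
  ⊛-zeroˡ b a≈0 n = sum-zero {suc n} _ λ i →
    trans (*-congʳ (a≈0 (toℕ i))) (zeroˡ (b (n ℕ.∸ toℕ i)))

  -- Splits the sum at its other end; matching this with the definitional split of `b ⊛ a` gives
  -- commutativity.
  ⊛-last : ∀ a b n → (a ⊛ b) (suc n) ≈ (a ⊛ (b ∘ suc)) n + a (suc n) * b 0
  ⊛-last a b zero    = solve 4 (λ x y z u → x :+ (y :+ z) := x :+ z :+ y) refl _ _ 0# 0#
  ⊛-last a b (suc n) = trans (+-congˡ (⊛-last (a ∘ suc) b n)) (sym (+-assoc _ _ _))

  ⊛-comm : ∀ a b → a ⊛ b ≐ b ⊛ a
  ⊛-comm a b zero    = +-congʳ (*-comm _ _)
  ⊛-comm a b (suc n) = begin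
    (a ⊛ b) (suc n)                       ≈⟨ ⊛-last a b n ⟩
    (a ⊛ (b ∘ suc)) n + a (suc n) * b 0   ≈⟨ +-cong (⊛-comm a (b ∘ suc) n) (*-comm _ _) ⟩
    ((b ∘ suc) ⊛ a) n + b 0 * a (suc n)   ≈⟨ +-comm _ _ ⟩
    (b ⊛ a) (suc n)                       ∎

  ⊛-constantˡ : ∀ x a b → a 0 ≈ x → (∀ n → a (suc n) ≈ 0#) → ∀ n → (a ⊛ b) n ≈ x * b n
  ⊛-constantˡ x a b a₀ a₊ zero    = trans (+-identityʳ _) (*-congʳ a₀)
  ⊛-constantˡ x a b a₀ a₊ (suc n) = trans (+-cong (*-congʳ a₀) (⊛-zeroˡ b a₊ n)) (+-identityʳ _)

  num-≈ᴸ : ∀ {f g} → start f ≡ start g → num f ≐ num g → f ≈ᴸ g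
  num-≈ᴸ {f} {g} ≡.refl eq k with k ℤ.- start f
  ... | + n      = eq n
  ... | -[1+ _ ] = refl

  delay : ℕ → (ℕ → Carrier) → ℕ → Carrier
  delay zero    a n       = a n
  delay (suc d) a zero    = 0#
  delay (suc d) a (suc n) = delay d a n

  delay-⊛ : ∀ d a b → delay d a ⊛ b ≐ delay d (a ⊛ b)
  delay-⊛ zero    a b n       = refl
  delay-⊛ (suc d) a b zero    = trans (+-identityʳ _) (zeroˡ _)
  delay-⊛ (suc d) a b (suc n) =
    trans (+-cong (zeroˡ _) (delay-⊛ d a b n)) (+-identityˡ _)

  delay-extend : ∀ d a n → delay d a n ≡ extend a (n ℤ.⊖ d)
  delay-extend zero    a n       = ≡.refl
  delay-extend (suc d) a zero    = ≡.refl
  delay-extend (suc d) a (suc n) =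
    ≡.trans (delay-extend d a n) (cong (extend a) (≡.sym (ℤ.[1+m]⊖[1+n]≡m⊖n n d)))

  -- Lowering the start and prepending as many zeros leaves the series unchanged.
  pad : ℕ → Laurent → Laurent
  pad d f = laurent (start f ℤ.- + d) (delay d (num f))

  pad-≈ᴸ : ∀ d f → pad d f ≈ᴸ f
  pad-≈ᴸ d f k with position (start f ℤ.- + d) k
  ... | below lt      = reflexive (≡.trans (coeff-below (pad d f) lt)
    (≡.sym (coeff-below f (ℤ.<-≤-trans lt (ℤ.i-j≤i (start f) (+ d))))))
  ... | from n ≡.refl = begin
    coeff (pad d f) (start f ℤ.- + d ℤ.+ + n)  ≡⟨ coeff-num (pad d f) n ⟩
    delay d (num f) n                          ≡⟨ delay-extend d (num f) n ⟩
    extend (num f) (n ℤ.⊖ d)                   ≡⟨ cong (extend (num f)) (ℤ.m-n≡m⊖n n d) ⟨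
    extend (num f) (+ n ℤ.- + d)               ≡⟨ cong (extend (num f)) (arith (start f) (+ d) (+ n)) ⟨
    coeff f (start f ℤ.- + d ℤ.+ + n)          ∎
    where
    arith : ∀ s d n → s ℤ.- d ℤ.+ n ℤ.- s ≡ n ℤ.- d
    arith = solve-∀

  ≈ᴸ-setoid : Setoid c ℓ
  ≈ᴸ-setoid = record
    { Carrier = Laurent
    ; _≈_ = _≈ᴸ_
    ; isEquivalence = record
      { refl  = λ k → refl
      ; sym   = λ p k → sym (p k)
      ; trans = λ p q k → trans (p k) (q k)
      }
    }

  open Setoid ≈ᴸ-setoid using () renaming (trans to ≈ᴸ-trans; sym to ≈ᴸ-sym)

  -- Equal series may start at different exponents; rewriting both from the smaller one
  -- reduces congruence and distributivity of *ᴸ to those of ⊛.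
  rebase : ℤ → Laurent → Laurent
  rebase s f = series s (coeff f)

  -- Rebasing amounts to padding by the difference d of the starts, and leading zeros of the left
  -- factor become leading zeros of the product.
  rebase-*ˡ : ∀ {s} f g → s ℤ.≤ start f → rebase s f *ᴸ g ≈ᴸ f *ᴸ g
  rebase-*ˡ {s} f g s≤ = ≈ᴸ-trans
    (num-≈ᴸ (cong (ℤ._+ start g) start≡)
      (⊛-cong {b = num g} (λ n → trans (sym (pad-≈ᴸ d f (s ℤ.+ + n))) (trans
        (reflexive (cong (λ i → coeff (pad d f) (i ℤ.+ + n)) start≡)) (reflexive (coeff-num (pad d f) n))))
        λ _ → refl))
    (≈ᴸ-trans
      (num-≈ᴸ (arith₂ (start f) (+ d) (start g)) (delay-⊛ d (num f) (num g)))
      (pad-≈ᴸ d (f *ᴸ g)))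
    where
    d = ℤ.∣ start f ℤ.- s ∣
    arith₁ : ∀ t s → s ≡ t ℤ.- (t ℤ.- s)
    arith₁ = solve-∀
    arith₂ : ∀ s d t → s ℤ.- d ℤ.+ t ≡ s ℤ.+ t ℤ.- d
    arith₂ = solve-∀
    start≡ : s ≡ start f ℤ.- + d
    start≡ = ≡.trans (arith₁ (start f) s)
      (cong (λ i → start f ℤ.- i) (≡.sym (ℤ.0≤i⇒+∣i∣≡i (ℤ.i≤j⇒0≤j-i s≤))))

  *ᴸ-congʳ : ∀ {f g} h → f ≈ᴸ g → f *ᴸ h ≈ᴸ g *ᴸ h
  *ᴸ-congʳ {f} {g} h f≈g = ≈ᴸ-trans (≈ᴸ-sym (rebase-*ˡ f h (ℤ.i⊓j≤i (start f) (start g)))) (≈ᴸ-trans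
    (num-≈ᴸ ≡.refl (⊛-cong {b = num h} (λ n → f≈g (s ℤ.+ + n)) λ _ → refl))
    (rebase-*ˡ g h (ℤ.i⊓j≤j (start f) (start g))))
    where s = start f ℤ.⊓ start g

  *ᴸ-comm : ∀ f g → f *ᴸ g ≈ᴸ g *ᴸ f
  *ᴸ-comm f g = num-≈ᴸ (ℤ.+-comm (start f) (start g)) (⊛-comm (num f) (num g))

  *ᴸ-cong : ∀ {f f′ g g′} → f ≈ᴸ f′ → g ≈ᴸ g′ → f *ᴸ g ≈ᴸ f′ *ᴸ g′
  *ᴸ-cong {f} {f′} {g} {g′} f≈ g≈ = ≈ᴸ-trans (*ᴸ-congʳ g f≈) (≈ᴸ-trans (*ᴸ-comm f′ g)
    (≈ᴸ-trans (*ᴸ-congʳ f′ g≈) (*ᴸ-comm g′ f′)))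

  *ᴸ-assoc : ∀ f g h → (f *ᴸ g) *ᴸ h ≈ᴸ f *ᴸ (g *ᴸ h)
  *ᴸ-assoc f g h = num-≈ᴸ (ℤ.+-assoc (start f) (start g) (start h)) (⊛-assoc (num f) (num g) (num h))

  *ᴸ-identityˡ : ∀ f → 1ᴸ *ᴸ f ≈ᴸ f
  *ᴸ-identityˡ f = num-≈ᴸ (ℤ.+-identityˡ (start f)) λ n →
    trans (⊛-constantˡ 1# (num 1ᴸ) (num f) refl (λ _ → refl) n) (*-identityˡ _)

  extend-+ : ∀ a b k → extend (λ n → a n + b n) k ≈ extend a k + extend b k
  extend-+ a b (+ n)    = refl
  extend-+ a b -[1+ _ ] = sym (+-identityʳ 0#)

  *ᴸ-distribʳ : ∀ h f g → (f +ᴸ g) *ᴸ h ≈ᴸ f *ᴸ h +ᴸ g *ᴸ h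
  *ᴸ-distribʳ h f g k = begin
    coeff ((f +ᴸ g) *ᴸ h) k
      -- By definition `num (f +ᴸ g)` adds the coefficients of `f` and `g` rebased to the smaller
      -- start.
      ≈⟨ num-≈ᴸ {(f +ᴸ g) *ᴸ h} {laurent (m ℤ.+ start h) λ n → num (f′ *ᴸ h) n + num (g′ *ᴸ h) n}
           ≡.refl (⊛-distribʳ (num h) (num f′) (num g′)) k ⟩
    extend (λ n → num (f′ *ᴸ h) n + num (g′ *ᴸ h) n) (k ℤ.- (m ℤ.+ start h))
      ≈⟨ extend-+ (num (f′ *ᴸ h)) (num (g′ *ᴸ h)) (k ℤ.- (m ℤ.+ start h)) ⟩
    coeff (f′ *ᴸ h) k + coeff (g′ *ᴸ h) k
      ≈⟨ +-cong (rebase-*ˡ f h (ℤ.i⊓j≤i (start f) (start g)) k) (rebase-*ˡ g h (ℤ.i⊓j≤j (start f) (start g)) k) ⟩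
    coeff (f *ᴸ h) k + coeff (g *ᴸ h) k
      ≈⟨ coeff-+ (f *ᴸ h) (g *ᴸ h) k ⟨
    coeff (f *ᴸ h +ᴸ g *ᴸ h) k ∎
    where
    m = start f ℤ.⊓ start g
    f′ = rebase m f
    g′ = rebase m g

  coeff-0ᴸ : ∀ k → coeff 0ᴸ k ≈ 0#
  coeff-0ᴸ k with k ℤ.- 0ℤ
  ... | + zero   = refl
  ... | + suc _  = refl
  ... | -[1+ _ ] = refl

  +ᴸ-cong : ∀ {f f′ g g′} → f ≈ᴸ f′ → g ≈ᴸ g′ → f +ᴸ g ≈ᴸ f′ +ᴸ g′
  +ᴸ-cong {f} {f′} {g} {g′} f≈ g≈ k = begin
    coeff (f +ᴸ g) k         ≈⟨ coeff-+ f g k ⟩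
    coeff f k + coeff g k    ≈⟨ +-cong (f≈ k) (g≈ k) ⟩
    coeff f′ k + coeff g′ k  ≈⟨ coeff-+ f′ g′ k ⟨
    coeff (f′ +ᴸ g′) k       ∎

  -ᴸ-cong : ∀ {f g} → f ≈ᴸ g → -ᴸ f ≈ᴸ -ᴸ g
  -ᴸ-cong {f} {g} f≈g k = begin
    coeff (-ᴸ f) k  ≈⟨ coeff-neg f k ⟩
    - coeff f k     ≈⟨ -‿cong (f≈g k) ⟩
    - coeff g k     ≈⟨ coeff-neg g k ⟨
    coeff (-ᴸ g) k  ∎

  +ᴸ-comm : ∀ f g → f +ᴸ g ≈ᴸ g +ᴸ f
  +ᴸ-comm f g k = begin
    coeff (f +ᴸ g) k       ≈⟨ coeff-+ f g k ⟩
    coeff f k + coeff g k  ≈⟨ +-comm _ _ ⟩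
    coeff g k + coeff f k  ≈⟨ coeff-+ g f k ⟨
    coeff (g +ᴸ f) k       ∎

  +ᴸ-assoc : ∀ f g h → (f +ᴸ g) +ᴸ h ≈ᴸ f +ᴸ (g +ᴸ h)
  +ᴸ-assoc f g h k = begin
    coeff ((f +ᴸ g) +ᴸ h) k                ≈⟨ coeff-+ (f +ᴸ g) h k ⟩
    coeff (f +ᴸ g) k + coeff h k           ≈⟨ +-congʳ (coeff-+ f g k) ⟩
    coeff f k + coeff g k + coeff h k      ≈⟨ +-assoc _ _ _ ⟩
    coeff f k + (coeff g k + coeff h k)    ≈⟨ +-congˡ (coeff-+ g h k) ⟨
    coeff f k + coeff (g +ᴸ h) k           ≈⟨ coeff-+ f (g +ᴸ h) k ⟨
    coeff (f +ᴸ (g +ᴸ h)) k                ∎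

  +ᴸ-identityˡ : ∀ f → 0ᴸ +ᴸ f ≈ᴸ f
  +ᴸ-identityˡ f k = begin
    coeff (0ᴸ +ᴸ f) k       ≈⟨ coeff-+ 0ᴸ f k ⟩
    coeff 0ᴸ k + coeff f k  ≈⟨ +-congʳ (coeff-0ᴸ k) ⟩
    0# + coeff f k          ≈⟨ +-identityˡ _ ⟩
    coeff f k               ∎

  -ᴸ-inverseˡ : ∀ f → -ᴸ f +ᴸ f ≈ᴸ 0ᴸ
  -ᴸ-inverseˡ f k = begin
    coeff (-ᴸ f +ᴸ f) k         ≈⟨ coeff-+ (-ᴸ f) f k ⟩
    coeff (-ᴸ f) k + coeff f k  ≈⟨ +-congʳ (coeff-neg f k) ⟩
    - coeff f k + coeff f k     ≈⟨ -‿inverseˡ _ ⟩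
    0#                          ≈⟨ coeff-0ᴸ k ⟨
    coeff 0ᴸ k                  ∎

  -- Allows the q-binomial theorem and the laws of box sums to be applied to Laurent series.
  laurentRing : CommutativeRing c ℓ
  laurentRing = record
    { _≈_ = _≈ᴸ_ ; _+_ = _+ᴸ_ ; _*_ = _*ᴸ_ ; -_ = -ᴸ_ ; 0# = 0ᴸ ; 1# = 1ᴸ
    ; isCommutativeRing = record
      { isRing = record
        { +-isAbelianGroup = record
          { isGroup = record
            { isMonoid = record
              { isSemigroup = record
                { isMagma = record
                  { isEquivalence = Setoid.isEquivalence ≈ᴸ-setoid
                  ; ∙-cong = λ {f} {f′} {g} {g′} → +ᴸ-cong {f} {f′} {g} {g′}
                  }
                ; assoc = +ᴸ-assoc
                }
              ; identity = comm∧idˡ⇒id {_∙_ = _+ᴸ_} +ᴸ-comm {0ᴸ} +ᴸ-identityˡ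
              }
            ; inverse = comm∧invˡ⇒inv {_∙_ = _+ᴸ_} {_⁻¹ = -ᴸ_} {e = 0ᴸ} +ᴸ-comm -ᴸ-inverseˡ
            ; ⁻¹-cong = λ {f} {g} → -ᴸ-cong {f} {g}
            }
          ; comm = +ᴸ-comm
          }
        ; *-cong = λ {f} {f′} {g} {g′} → *ᴸ-cong {f} {f′} {g} {g′}
        ; *-assoc = *ᴸ-assoc
        ; *-identity = comm∧idˡ⇒id {_∙_ = _*ᴸ_} *ᴸ-comm {1ᴸ} *ᴸ-identityˡ
        ; distrib = comm∧distrʳ⇒distr {_∙_ = _*ᴸ_} {_◦_ = _+ᴸ_} (λ {f} {f′} {g} {g′} → +ᴸ-cong {f} {f′} {g} {g′})
            *ᴸ-comm *ᴸ-distribʳ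
        }
      ; *-comm = *ᴸ-comm
      }
    }
    where open Consequences ≈ᴸ-setoid

-- Monomials and Pochhammer symbols as Laurent series

module TadpoleProduct {c ℓ} (R : CommutativeRing c ℓ) where
  open CommutativeRing R hiding (zero)
  open FormalSeries R
  open LaurentRing R
  open BoxSums R
  open MonoidSums
  module L = CommutativeRing laurentRing
  -- Taken for finite sums and box sums whose values are Laurent series.
  module 𝕃 = FormalSeries laurentRing
  module BoxSumᴸ = BoxSums laurentRing
  open import Algebra.Properties.Ring ring using (-0#≈0#; x∙y⁻¹≈ε⇒x≈y; -‿involutive; x≈y⇒x∙y⁻¹≈ε)
  open import Algebra.Properties.Semiring.Sum semiring using (sum-cong-≋)
  open import Algebra.Properties.Semiring.Sum L.semiring using ()
    renaming (*-distribˡ-sum to *ᴸ-distribˡ-sum)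
  import Algebra.Properties.CommutativeSemigroup L.*-commutativeSemigroup as L*
  module ≈-Reasoning = SetoidReasoning setoid hiding (start)
  module ≈ᴸ-Reasoning = SetoidReasoning ≈ᴸ-setoid hiding (start)

  ·t^-cong : ∀ {x y i j} → x ≈ y → i ≡ j → x ·t^ i ≈ᴸ y ·t^ j
  ·t^-cong x≈y i≡j = num-≈ᴸ i≡j λ where
    zero    → x≈y
    (suc _) → refl

  ·t^-* : ∀ x i y j → x ·t^ i *ᴸ y ·t^ j ≈ᴸ (x * y) ·t^ (i ℤ.+ j)
  ·t^-* x i y j = num-≈ᴸ ≡.refl λ n →
    trans (⊛-constantˡ x (num (x ·t^ i)) (num (y ·t^ j)) refl (λ _ → refl) n) (scale n)
    where
    scale : ∀ n → x * num (y ·t^ j) n ≈ num ((x * y) ·t^ (i ℤ.+ j)) n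
    scale zero    = refl
    scale (suc _) = zeroʳ x

  -ᴸ-·t^ : ∀ x i → -ᴸ (x ·t^ i) ≈ᴸ (- x) ·t^ i
  -ᴸ-·t^ x i = num-≈ᴸ ≡.refl λ where
    zero    → refl
    (suc _) → -0#≈0#

  q^-+ : ∀ m n → q^ (m ℕ.+ n) ≈ᴸ q^ m *ᴸ q^ n
  q^-+ m n = L.sym {q^ m *ᴸ q^ n} {q^ (m ℕ.+ n)} (L.trans {q^ m *ᴸ q^ n}
    (·t^-* 1# (+ (2 ℕ.* m)) 1# (+ (2 ℕ.* n)))
    (·t^-cong (*-identityˡ 1#) (cong +_ (≡.sym (ℕ.*-distribˡ-+ 2 m n)))))

  1/qq-suc : ∀ n → (1ᴸ -ᴸ q^ suc n) *ᴸ 1/qq (suc n) ≈ᴸ 1/qq n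
  1/qq-suc n = let open ≈ᴸ-Reasoning in begin
    (1ᴸ -ᴸ q^ suc n) *ᴸ (1/qq n *ᴸ geometric n)  ≈⟨ L*.x∙yz≈y∙xz (1ᴸ -ᴸ q^ suc n) (1/qq n) (geometric n) ⟩
    1/qq n *ᴸ ((1ᴸ -ᴸ q^ suc n) *ᴸ geometric n)  ≈⟨ *ᴸ-cong {1/qq n} {1/qq n} (λ _ → refl) (geometric-inverse n) ⟩
    1/qq n *ᴸ 1ᴸ                                 ≈⟨ L.*-identityʳ (1/qq n) ⟩
    1/qq n                                       ∎

  open QBinomial laurentRing q^_ (λ _ → refl) (q^-+ 1) 1/qq (λ _ → refl) 1/qq-suc

  -- The base b is given only up to `≈ᴸ`, because in the application it is the monomial -z t while
  -- `a *ᴸ q^ m` is a product.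
  poch-+ : ∀ a b m n → b ≈ᴸ a *ᴸ q^ m → poch a (m ℕ.+ n) ≈ᴸ poch a m *ᴸ poch b n
  poch-+ a b m zero    b≈ = L.trans {poch a (m ℕ.+ 0)} (L.reflexive (cong (poch a) (ℕ.+-identityʳ m)))
    (L.sym {poch a m *ᴸ 1ᴸ} (L.*-identityʳ (poch a m)))
  poch-+ a b m (suc n) b≈ = let open ≈ᴸ-Reasoning in begin
    poch a (m ℕ.+ suc n)
      ≡⟨ cong (poch a) (ℕ.+-suc m n) ⟩
    poch a (m ℕ.+ n) *ᴸ (1ᴸ -ᴸ a *ᴸ q^ (m ℕ.+ n))
      ≈⟨ *ᴸ-cong {poch a (m ℕ.+ n)} {poch a m *ᴸ poch b n} (poch-+ a b m n b≈)
           (+ᴸ-cong {1ᴸ} {1ᴸ} { -ᴸ (a *ᴸ q^ (m ℕ.+ n))} { -ᴸ (b *ᴸ q^ n)} (λ _ → refl)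
             (-ᴸ-cong {a *ᴸ q^ (m ℕ.+ n)} {b *ᴸ q^ n} shift)) ⟩
    poch a m *ᴸ poch b n *ᴸ (1ᴸ -ᴸ b *ᴸ q^ n)
      ≈⟨ *ᴸ-assoc (poch a m) (poch b n) (1ᴸ -ᴸ b *ᴸ q^ n) ⟩
    poch a m *ᴸ poch b (suc n) ∎
    where
    shift : a *ᴸ q^ (m ℕ.+ n) ≈ᴸ b *ᴸ q^ n
    shift = let open ≈ᴸ-Reasoning in begin
      a *ᴸ q^ (m ℕ.+ n)      ≈⟨ *ᴸ-cong {a} {a} (λ _ → refl) (q^-+ m n) ⟩
      a *ᴸ (q^ m *ᴸ q^ n)    ≈⟨ *ᴸ-assoc a (q^ m) (q^ n) ⟨
      a *ᴸ q^ m *ᴸ q^ n      ≈⟨ *ᴸ-congʳ {b} {a *ᴸ q^ m} (q^ n) b≈ ⟨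
      b *ᴸ q^ n              ∎

  -- Order estimates and truncation

  order-cong : ∀ {f g m} → f ≈ᴸ g → Order≥ m f → Order≥ m g
  order-cong f≈g of k k<m = trans (sym (f≈g k)) (of k k<m)

  order-minus : ∀ {f g m} → Order≥ m f → Order≥ m g → Order≥ m (f -ᴸ g)
  order-minus {f} {g} of og k k<m = let open ≈-Reasoning in begin
    coeff (f -ᴸ g) k             ≈⟨ coeff-+ f (-ᴸ g) k ⟩
    coeff f k + coeff (-ᴸ g) k   ≈⟨ +-cong (of k k<m) (trans (coeff-neg g k) (-‿cong (og k k<m))) ⟩
    0# - 0#                      ≈⟨ -‿inverseʳ 0# ⟩
    0#                           ∎

  order-falling : ∀ n k → Order≥ 0ℤ (falling n k)
  order-falling n       zero    = order-start 1ᴸ ℤ.≤-refl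
  order-falling zero    (suc k) = order-start 0ᴸ ℤ.≤-refl
  order-falling (suc n) (suc k) = order-* {1ᴸ -ᴸ q^ suc n} {falling n k}
    (order-1- {q^ suc n} ℤ.≤-refl (·t^-order 1# (2 ℕ.* suc n))) (order-falling n k)

  -- The factor 1 - q^{n+1-k} with the least power of q dictates the bound, and the step of the
  -- induction only adds a term of order 2(n+1) or more. For k > n the truncated subtraction turns
  -- the bound into 0.
  order-falling-1 : ∀ n k → Order≥ (+ (2 ℕ.* (suc n ℕ.∸ k))) (falling n k -ᴸ 1ᴸ)
  order-falling-1 n       zero    = λ j _ → trans (L.-‿inverseʳ 1ᴸ j) (coeff-0ᴸ j)
  order-falling-1 zero    (suc k) = subst (λ i → Order≥ (+ (2 ℕ.* i)) (0ᴸ -ᴸ 1ᴸ))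
    (≡.sym (ℕ.0∸n≡0 k)) (order-minus {0ᴸ} {1ᴸ} (order-start 0ᴸ ℤ.≤-refl) (order-start 1ᴸ ℤ.≤-refl))
  order-falling-1 (suc n) (suc k) = order-cong
    {(falling n k -ᴸ 1ᴸ) -ᴸ q^ suc n *ᴸ falling n k} {falling (suc n) (suc k) -ᴸ 1ᴸ}
    (λ j → sym (falling-suc-1 n k j))
    (order-minus {falling n k -ᴸ 1ᴸ} {q^ suc n *ᴸ falling n k} (order-falling-1 n k)
      (order-weaken {q^ suc n *ᴸ falling n k}
        (ℤ.≤-trans (ℤ.+≤+ (ℕ.*-monoʳ-≤ 2 (ℕ.m∸n≤m (suc n) k))) (ℤ.≤-reflexive (≡.sym (ℤ.+-identityʳ _))))
        (order-* {q^ suc n} {falling n k} (order-monomial 1# _) (order-falling n k))))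

  -- The error f (g - h) has order at least a + b. This is how infinite objects are exchanged for
  -- finite ones below.
  *ᴸ-agree : ∀ f {g h a b} → Order≥ a f → (∀ k → k ℤ.< b → coeff g k ≈ coeff h k) →
             ∀ k → k ℤ.< a ℤ.+ b → coeff (f *ᴸ g) k ≈ coeff (f *ᴸ h) k
  *ᴸ-agree f {g} {h} {a} {b} of eq k lt = x∙y⁻¹≈ε⇒x≈y _ _ (let open ≈-Reasoning in begin
    coeff (f *ᴸ g) k - coeff (f *ᴸ h) k         ≈⟨ +-congˡ (coeff-neg (f *ᴸ h) k) ⟨
    coeff (f *ᴸ g) k + coeff (-ᴸ (f *ᴸ h)) k    ≈⟨ coeff-+ (f *ᴸ g) (-ᴸ (f *ᴸ h)) k ⟨
    coeff (f *ᴸ g -ᴸ f *ᴸ h) k                  ≈⟨ x[y-z]≈xy-xz f g h k ⟨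
    coeff (f *ᴸ (g -ᴸ h)) k                     ≈⟨ order-* {f} {g -ᴸ h} of diff k lt ⟩
    0#                                          ∎)
    where
    open import Algebra.Properties.Ring L.ring using (x[y-z]≈xy-xz)
    diff : Order≥ b (g -ᴸ h)
    diff j j<b = let open ≈-Reasoning in begin
      coeff (g -ᴸ h) j              ≈⟨ coeff-+ g (-ᴸ h) j ⟩
      coeff g j + coeff (-ᴸ h) j    ≈⟨ +-congˡ (coeff-neg h j) ⟩
      coeff g j - coeff h j         ≈⟨ x≈y⇒x∙y⁻¹≈ε (eq j j<b) ⟩
      0#                            ∎

  -- Coefficients of sums and limits

  coeff-sum : ∀ {N} (f : Vector Laurent N) k → coeff (𝕃.sum f) k ≈ sum λ i → coeff (f i) k
  coeff-sum {zero}  f k = coeff-0ᴸ k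
  coeff-sum {suc N} f k = trans (coeff-+ (f zero) (𝕃.sum (f ∘ suc)) k) (+-congˡ (coeff-sum (f ∘ suc) k))

  coeff-boxSum : ∀ r N (f : Vec ℕ r → Laurent) k →
                 coeff (𝕃.boxSum r N f) k ≈ boxSum r N λ n → coeff (f n) k
  coeff-boxSum zero    N f k = refl
  coeff-boxSum (suc r) N f k = trans
    (coeff-sum {N} (λ i → 𝕃.boxSum r N λ n → f (toℕ i ∷ n)) k)
    (sum-cong-≋ {N} λ i → coeff-boxSum r N (λ n → f (toℕ i ∷ n)) k)

  -- Enlarging the box adds only terms without t^k, so one K serves for several sums and all
  -- exponents below K.
  coeff-infiniteSum : ∀ {r} (f : Vec ℕ r → Laurent) o {K} k → k ℕ.< K →
    coeff (infiniteSum f (summable f o)) (+ k) ≈ boxSum r K λ n → coeff (f n) (+ k)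
  coeff-infiniteSum {r} f o k k<K = trans
    (reflexive (coeff-num (infiniteSum f (summable f o)) k))
    (sym (boxSum-truncate r (λ n → coeff (f n) (+ k)) k<K (Summable.outside (summable f o) (+ k))))

  coeff-poch∞ : ∀ a oa {K} k → k ℕ.< K → coeff (poch∞ a oa) (+ k) ≈ coeff (poch a K) (+ k)
  coeff-poch∞ a oa k k<K = trans (reflexive (coeff-num (poch∞ a oa) k))
    (sym (Converges.stable (poch-converges a oa) (+ k) _ k<K))

  -- The summands over a fixed index vector n

  module _ {r} (x : Vector Carrier (suc (suc r))) (n : Vec ℕ (suc r)) where
    private
      z = last x
      l = Vec.last n

    a : Laurent
    a = (- z) ·t^ (1ℤ ℤ.- + (2 ℕ.* l))

    -- What the summands of both sides share: the part of the tadpole summand independent of j, and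
    -- the 𝒜 summand without its Pochhammer symbol.
    prefix : Laurent
    prefix = monomial (init x) n ·t^ quad (cartanA (suc r)) n *ᴸ productᴸ (λ i → 1/qq (lookup n i))

    -- This is (-a)^j q^{j(j-1)/2} for a = -z q^{1/2-l}, collected into one monomial; `euler-zero`
    -- and `euler-suc` confirm it.
    euler : ℕ → Laurent
    euler j = (z ^ j) ·t^ (+ j ℤ.* + j ℤ.- + 2 ℤ.* (+ l ℤ.* + j))

    euler-zero : euler 0 ≈ᴸ 1ᴸ
    euler-zero = ·t^-cong refl (arith (+ l))
      where
      arith : ∀ l → 0ℤ ℤ.- + 2 ℤ.* (l ℤ.* 0ℤ) ≡ 0ℤ
      arith = solve-∀

    euler-suc : ∀ j → euler (suc j) ≈ᴸ euler j *ᴸ (-ᴸ a *ᴸ q^ j)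
    euler-suc j = let open ≈ᴸ-Reasoning in begin
      (z * z ^ j) ·t^ (+ suc j ℤ.* + suc j ℤ.- + 2 ℤ.* (+ l ℤ.* + suc j))
        ≈⟨ ·t^-cong (trans (*-comm z (z ^ j)) (*-congˡ (sym (trans (*-identityʳ _) (-‿involutive z))))) exponent ⟩
      (z ^ j * (- - z * 1#)) ·t^ (E ℤ.+ (s ℤ.+ + (2 ℕ.* j)))
        ≈⟨ ·t^-* (z ^ j) E (- - z * 1#) (s ℤ.+ + (2 ℕ.* j)) ⟨
      euler j *ᴸ (- - z * 1#) ·t^ (s ℤ.+ + (2 ℕ.* j))
        ≈⟨ *ᴸ-cong {euler j} {euler j} (λ _ → refl) (·t^-* (- - z) s 1# (+ (2 ℕ.* j))) ⟨
      euler j *ᴸ ((- - z) ·t^ s *ᴸ q^ j)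
        ≈⟨ *ᴸ-cong {euler j} {euler j} (λ _ → refl) (*ᴸ-congʳ { -ᴸ a} (q^ j) (-ᴸ-·t^ (- z) s)) ⟨
      euler j *ᴸ (-ᴸ a *ᴸ q^ j) ∎
      where
      s = 1ℤ ℤ.- + (2 ℕ.* l)
      E = + j ℤ.* + j ℤ.- + 2 ℤ.* (+ l ℤ.* + j)
      arith : ∀ l j → (1ℤ ℤ.+ j) ℤ.* (1ℤ ℤ.+ j) ℤ.- + 2 ℤ.* (l ℤ.* (1ℤ ℤ.+ j))
              ≡ (j ℤ.* j ℤ.- + 2 ℤ.* (l ℤ.* j)) ℤ.+ ((1ℤ ℤ.- + 2 ℤ.* l) ℤ.+ + 2 ℤ.* j)
      arith = solve-∀
      exponent : + suc j ℤ.* + suc j ℤ.- + 2 ℤ.* (+ l ℤ.* + suc j) ≡ E ℤ.+ (s ℤ.+ + (2 ℕ.* j))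
      exponent = ≡.trans (arith (+ l) (+ j)) (≡.sym (≡.cong₂ (λ u v → E ℤ.+ ((1ℤ ℤ.- u) ℤ.+ v))
        (ℤ.pos-* 2 l) (ℤ.pos-* 2 j)))

    𝒯-term-∷ʳ : ∀ j → 𝒯-term x (n ∷ʳ j) ≈ᴸ prefix *ᴸ (euler j *ᴸ 1/qq j)
    𝒯-term-∷ʳ j = let open ≈ᴸ-Reasoning in begin
      monomial x (n ∷ʳ j) ·t^ quad (tadpole _) (n ∷ʳ j) *ᴸ productᴸ (λ i → 1/qq (lookup (n ∷ʳ j) i))
        ≈⟨ *ᴸ-cong {monomial x (n ∷ʳ j) ·t^ quad (tadpole _) (n ∷ʳ j)}
             (·t^-cong (sum-∷ʳ *-monoid (λ i m → x i ^ m) n j) (tadpole-∷ʳ n j))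
             (sum-∷ʳ L.*-monoid (λ _ → 1/qq) n j) ⟩
      (μ * z ^ j) ·t^ (Q ℤ.+ E) *ᴸ (Π *ᴸ 1/qq j)
        ≈⟨ *ᴸ-congʳ {μ ·t^ Q *ᴸ euler j} (Π *ᴸ 1/qq j) (·t^-* μ Q (z ^ j) E) ⟨
      μ ·t^ Q *ᴸ euler j *ᴸ (Π *ᴸ 1/qq j)
        ≈⟨ L*.interchange (μ ·t^ Q) (euler j) Π (1/qq j) ⟩
      prefix *ᴸ (euler j *ᴸ 1/qq j) ∎
      where
      μ = monomial (init x) n
      Q = quad (cartanA (suc r)) n
      E = + j ℤ.* + j ℤ.- + 2 ℤ.* (+ l ℤ.* + j)
      Π = productᴸ (λ i → 1/qq (lookup n i))

    -- Since a q^l = -z q^{1/2}, the truncated infinite product continues (a;q)_l exactly where it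
    -- ends.
    poch-*-𝒜-term : ∀ M → poch ((- z) ·t^ 1ℤ) M *ᴸ 𝒜-term (init x) z n ≈ᴸ prefix *ᴸ poch a (l ℕ.+ M)
    poch-*-𝒜-term M = let open ≈ᴸ-Reasoning in begin
      B *ᴸ (μ *ᴸ A *ᴸ Π)        ≈⟨ *ᴸ-comm B (μ *ᴸ A *ᴸ Π) ⟩
      μ *ᴸ A *ᴸ Π *ᴸ B          ≈⟨ *ᴸ-congʳ {μ *ᴸ A *ᴸ Π} {prefix *ᴸ A} B (L*.xy∙z≈xz∙y μ A Π) ⟩
      prefix *ᴸ A *ᴸ B          ≈⟨ *ᴸ-assoc prefix A B ⟩
      prefix *ᴸ (A *ᴸ B)        ≈⟨ *ᴸ-cong {prefix} {prefix} (λ _ → refl) (poch-+ a ((- z) ·t^ 1ℤ) l M shift) ⟨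
      prefix *ᴸ poch a (l ℕ.+ M) ∎
      where
      μ = monomial (init x) n ·t^ quad (cartanA (suc r)) n
      Π = productᴸ (λ i → 1/qq (lookup n i))
      A = poch a l
      B = poch ((- z) ·t^ 1ℤ) M
      arith : ∀ l → 1ℤ ≡ 1ℤ ℤ.- l ℤ.+ l
      arith = solve-∀
      shift : (- z) ·t^ 1ℤ ≈ᴸ a *ᴸ q^ l
      shift = L.sym {a *ᴸ q^ l} (L.trans {a *ᴸ q^ l} (·t^-* (- z) (1ℤ ℤ.- + (2 ℕ.* l)) 1# (+ (2 ℕ.* l)))
        (·t^-cong (*-identityʳ (- z)) (≡.sym (arith (+ (2 ℕ.* l))))))

    private
      binomialTerm : ℕ → ℕ → Laurent
      binomialTerm N j = euler j *ᴸ (falling N j *ᴸ 1/qq j)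

    poch-expansion : ∀ N → poch a N ≈ᴸ 𝕃.sum {suc N} (λ j → binomialTerm N (toℕ j))
    poch-expansion = q-binomial a (poch a) (λ _ → refl) (λ _ _ → refl) euler euler-zero euler-suc

    𝒯-term-agree : ∀ N j k → j ℕ.≤ N → k ℕ.≤ N →
      coeff (prefix *ᴸ binomialTerm N j) (+ k) ≈ coeff (𝒯-term x (n ∷ʳ j)) (+ k)
    𝒯-term-agree N j k j≤N k≤N = let open ≈-Reasoning in begin
      coeff (prefix *ᴸ (euler j *ᴸ (φ *ᴸ 1/qq j))) (+ k)   ≈⟨ rearrange (+ k) ⟩
      coeff (T *ᴸ φ) (+ k)                                 ≈⟨ *ᴸ-agree T {φ} {1ᴸ} (order-𝒯 x (n ∷ʳ j)) agree (+ k) k< ⟩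
      coeff (T *ᴸ 1ᴸ) (+ k)                                ≈⟨ L.*-identityʳ T (+ k) ⟩
      coeff T (+ k)                                        ∎
      where
      T = 𝒯-term x (n ∷ʳ j)
      φ = falling N j
      d = 2 ℕ.* (suc N ℕ.∸ j)

      rearrange : prefix *ᴸ (euler j *ᴸ (φ *ᴸ 1/qq j)) ≈ᴸ T *ᴸ φ
      rearrange = let open ≈ᴸ-Reasoning in begin
        prefix *ᴸ (euler j *ᴸ (φ *ᴸ 1/qq j))
          ≈⟨ *ᴸ-cong {prefix} {prefix} (λ _ → refl) (L*.x∙yz≈xz∙y (euler j) φ (1/qq j)) ⟩
        prefix *ᴸ (euler j *ᴸ 1/qq j *ᴸ φ)
          ≈⟨ *ᴸ-assoc prefix (euler j *ᴸ 1/qq j) φ ⟨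
        prefix *ᴸ (euler j *ᴸ 1/qq j) *ᴸ φ
          ≈⟨ *ᴸ-congʳ {T} φ (𝒯-term-∷ʳ j) ⟨
        T *ᴸ φ ∎

      agree : ∀ i → i ℤ.< + d → coeff φ i ≈ coeff 1ᴸ i
      agree i i<d = x∙y⁻¹≈ε⇒x≈y _ _ (trans
        (sym (trans (coeff-+ φ (-ᴸ 1ᴸ) i) (+-congˡ (coeff-neg 1ᴸ i))))
        (order-falling-1 N j i i<d))

      -- The quadratic form is at least its last index j, and j + 2(N+1-j) ≥ N+1 > k because j ≤ N.
      k< : + k ℤ.< quad (tadpole _) (n ∷ʳ j) ℤ.+ + d
      k< = ℤ.<-≤-trans (ℤ.+<+ k<j+d) (ℤ.+-monoˡ-≤ (+ d)
        (subst (λ i → + i ℤ.≤ quad (tadpole _) (n ∷ʳ j)) (lookup-∷ʳ-fromℕ n j)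
          (tadpole-bound (n ∷ʳ j) (fromℕ _))))
        where
        k<j+d : k ℕ.< j ℕ.+ d
        k<j+d = let open ℕ.≤-Reasoning in begin
          suc k                     ≤⟨ ℕ.s≤s k≤N ⟩
          suc N                     ≡⟨ ℕ.m+[n∸m]≡n (ℕ.m≤n⇒m≤1+n j≤N) ⟨
          j ℕ.+ (suc N ℕ.∸ j)       ≤⟨ ℕ.+-monoʳ-≤ j (ℕ.m≤m+n _ _) ⟩
          j ℕ.+ d                   ∎

    poch-*-𝒜-term-coeff : ∀ k →
      coeff (poch ((- z) ·t^ 1ℤ) (suc k) *ᴸ 𝒜-term (init x) z n) (+ k)
      ≈ ∑[ j < suc k ] coeff (𝒯-term x (n ∷ʳ toℕ j)) (+ k)
    poch-*-𝒜-term-coeff k = let open ≈-Reasoning in begin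
      coeff (poch ((- z) ·t^ 1ℤ) (suc k) *ᴸ 𝒜-term (init x) z n) (+ k)
        ≈⟨ poch-*-𝒜-term (suc k) (+ k) ⟩
      coeff (prefix *ᴸ poch a N) (+ k)
        ≈⟨ *ᴸ-cong {prefix} {prefix} (λ _ → refl) (poch-expansion N) (+ k) ⟩
      coeff (prefix *ᴸ 𝕃.sum {suc N} (λ j → binomialTerm N (toℕ j))) (+ k)
        ≈⟨ *ᴸ-distribˡ-sum {suc N} prefix (λ j → binomialTerm N (toℕ j)) (+ k) ⟩
      coeff (𝕃.sum {suc N} (λ j → prefix *ᴸ binomialTerm N (toℕ j))) (+ k)
        ≈⟨ coeff-sum {suc N} (λ j → prefix *ᴸ binomialTerm N (toℕ j)) (+ k) ⟩
      ∑[ j < suc N ] coeff (prefix *ᴸ binomialTerm N (toℕ j)) (+ k)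
        ≈⟨ sum-cong-≋ {suc N} (λ j → 𝒯-term-agree N (toℕ j) k (ℕ.s≤s⁻¹ (Fin.toℕ<n j)) k≤N) ⟩
      ∑[ j < suc N ] coeff (𝒯-term x (n ∷ʳ toℕ j)) (+ k)
        -- The number N depends on n through l. Summands with j > k have order above k, so dropping
        -- them gives a range common to all n.
        ≈⟨ sum-truncate +-monoid (λ j → coeff (𝒯-term x (n ∷ʳ j)) (+ k)) (ℕ.s≤s k≤N) (λ j k<j →
             Summable.outside (𝒯-summable x) (+ k) (n ∷ʳ j) (fromℕ _)
               (subst (suc k ℕ.≤_) (≡.sym (lookup-∷ʳ-fromℕ n j)) k<j)) ⟩
      ∑[ j < suc k ] coeff (𝒯-term x (n ∷ʳ toℕ j)) (+ k) ∎
      where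
      N = l ℕ.+ suc k
      k≤N : k ℕ.≤ N
      k≤N = ℕ.≤-trans (ℕ.n≤1+n k) (ℕ.m≤n+m (suc k) l)

  -- Comparison of the coefficients of both sides

  𝒯≈poch∞*𝒜 : ∀ m (x : Vector Carrier (suc (suc m))) →
    𝒯 x ≈ᴸ poch∞ ((- last x) ·t^ 1ℤ) (·t^-order (- last x) 1) *ᴸ 𝒜 (init x) (last x)
  -- All three series start at exponent 0, so negative coefficients compute to zero.
  𝒯≈poch∞*𝒜 m x -[1+ k ] = refl
  𝒯≈poch∞*𝒜 m x (+ k)    = let open ≈-Reasoning in begin
    coeff (𝒯 x) (+ k)
      ≈⟨ coeff-infiniteSum (𝒯-term x) (order-𝒯 x) k ℕ.≤-refl ⟩
    boxSum (suc (suc m)) K (λ n → coeff (𝒯-term x n) (+ k))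
      ≈⟨ boxSum-∷ʳ (suc m) K (λ n → coeff (𝒯-term x n) (+ k)) ⟩
    boxSum (suc m) K (λ n → ∑[ j < K ] coeff (𝒯-term x (n ∷ʳ toℕ j)) (+ k))
      ≈⟨ boxSum-cong (suc m) K (λ n → poch-*-𝒜-term-coeff x n k) ⟨
    boxSum (suc m) K (λ n → coeff (P *ᴸ A n) (+ k))
      ≈⟨ coeff-boxSum (suc m) K (λ n → P *ᴸ A n) (+ k) ⟨
    coeff (𝕃.boxSum (suc m) K (λ n → P *ᴸ A n)) (+ k)
      ≈⟨ BoxSumᴸ.boxSum-*ˡ (suc m) K P A (+ k) ⟨
    coeff (P *ᴸ ΣA) (+ k)
      ≈⟨ *ᴸ-agree P {𝒜 (init x) z} {ΣA} (order-poch {b} ob K) agree-𝒜 (+ k) k<K ⟨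
    coeff (P *ᴸ 𝒜 (init x) z) (+ k)
      -- `*ᴸ-agree` exchanges the right factor, so the product is turned around to replace `P` by
      -- its limit.
      ≈⟨ *ᴸ-comm P (𝒜 (init x) z) (+ k) ⟩
    coeff (𝒜 (init x) z *ᴸ P) (+ k)
      ≈⟨ *ᴸ-agree (𝒜 (init x) z) {poch∞ b ob} {P} (order-start (𝒜 (init x) z) ℤ.≤-refl) agree-poch (+ k) k<K ⟨
    coeff (𝒜 (init x) z *ᴸ poch∞ b ob) (+ k)
      ≈⟨ *ᴸ-comm (𝒜 (init x) z) (poch∞ b ob) (+ k) ⟩
    coeff (poch∞ b ob *ᴸ 𝒜 (init x) z) (+ k) ∎
    where
    -- The side of the box, the range of j and the length of the truncated Pochhammer symbol; k + 1
    -- suffices for the coefficient of t^k in each.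
    K = suc k
    z = last x
    b = (- z) ·t^ 1ℤ
    ob = ·t^-order (- z) 1
    P = poch b K
    A = 𝒜-term (init x) z
    ΣA = 𝕃.boxSum (suc m) K A
    k<K : + k ℤ.< + K
    k<K = ℤ.+<+ ℕ.≤-refl

    agree-𝒜 : ∀ i → i ℤ.< + K → coeff (𝒜 (init x) z) i ≈ coeff ΣA i
    agree-𝒜 (+ i)    (ℤ.+<+ i<K) = trans
      (coeff-infiniteSum A (order-𝒜 (init x) z) i i<K)
      (sym (coeff-boxSum (suc m) K A (+ i)))
    agree-𝒜 -[1+ i ] _ = sym (trans (coeff-boxSum (suc m) K A -[1+ i ])
      (boxSum-zero (suc m) K λ n → Summable.order (𝒜-summable (init x) z) n -[1+ i ] ℤ.-<+))

    agree-poch : ∀ i → i ℤ.< + K → coeff (poch∞ b ob) i ≈ coeff P i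
    agree-poch (+ i)    (ℤ.+<+ i<K) = coeff-poch∞ b ob i i<K
    agree-poch -[1+ i ] _           = sym (order-poch {b} ob K -[1+ i ] ℤ.-<+)

lemma2p1 : ∀ {c ℓ} (R : CommutativeRing c ℓ) (let open CommutativeRing R) (let open FormalSeries R)
    (m : ℕ) (x : Vector Carrier (suc (suc m))) →
    𝒯 x ≈ᴸ poch∞ ((- last x) ·t^ 1ℤ) (·t^-order (- last x) 1) *ᴸ 𝒜 (init x) (last x)
lemma2p1 R = TadpoleProduct.𝒯≈poch∞*𝒜 R
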